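{- Let $d,k$ be positive integers. There exists $N=N(d,k)$ such that for every integer $n\ge N$, the value of the multiple-treasures-per-door search game with parameters $(n,d,k)$ is $$v_M(n,d,k)=\frac{k^d}{\binom{n+d-1}d}.$$
   Context: The multiple-treasures-per-door search game with parameters $(n,d,k)$ is the following two-player zero-sum game. First the hider places $d$ treasures behind $n$ doors; several treasures may be placed behind the same door. Then the searcher plays rounds: in each round she selects (guesses) a set of at most $k$ doors. If none of the selected doors hides a treasure not yet found, she loses immediately. Otherwise the hider reveals one not-yet-found treasure behind one of the selected doors (the hider chooses which one if there are several). The searcher wins if she finds all $d$ treasures with a total of $d$ guesses (rounds). The searcher's choices may be randomized and may depend on all previous answers; the hider may randomize. The value $v_M(n,d,k)$ is the probability that the searcher wins when both players play optimally. -}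

module Defs where

open import Data.Bool.Base using (Bool; false; if_then_else_)
open import Data.Fin.Base using (Fin)
open import Data.Fin.Properties using (_≟_; any?; all?)
open import Data.Fin.Subset using (Subset; _∈_; ∣_∣)
open import Data.Fin.Subset.Properties using (_∈?_)
open import Data.List.Base using (List; []; _∷_; map; foldr; filter; length)
open import Data.List.Relation.Unary.All using (All)
open import Data.Nat.Base using (ℕ; zero; suc; _≤_; _<_)
open import Data.Nat.Properties using () renaming (_≟_ to _≟ℕ_; _<?_ to _<ℕ?_)
open import Data.Product.Base using (Σ-syntax; ∃; _×_; _,_; proj₁; proj₂)
open import Data.Rational.Base as ℚ using (ℚ; 0ℚ; 1ℚ)
open import Data.Vec.Base as Vec using (Vec; lookup)
open import Relation.Binary.PropositionalEquality using (_≡_)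
open import Relation.Nullary using (Dec; does)
open import Relation.Nullary.Decidable using (_×-dec_)

sumℚ : List ℚ → ℚ
sumℚ = foldr ℚ._+_ 0ℚ

-- Finitely supported probability distributions.  An element may occur in
-- several atoms; its probability is then the sum of their weights.
record Mixed (A : Set) : Set where
  field
    atoms  : List (A × ℚ)
    nonNeg : All (λ a → 0ℚ ℚ.≤ proj₂ a) atoms
    total  : sumℚ (map proj₂ atoms) ≡ 1ℚ

𝔼 : {A : Set} → Mixed A → (A → ℚ) → ℚ
𝔼 μ f = sumℚ (map (λ a → proj₂ a ℚ.* f (proj₁ a)) (Mixed.atoms μ))

-- v is the value when the maximiser has a mixed strategy guaranteeing at
-- least v and the minimiser has one guaranteeing at most v.  Rational weights
-- lose nothing: a game with finitely many essentially different pure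
-- strategies and rational payoffs has a rational value, attained by optimal
-- mixed strategies with rational weights, and guarantees against rational
-- mixed strategies extend to real ones by linearity.
record IsValue {A B : Set} (payoff : A → B → ℚ) (v : ℚ) : Set where
  field
    maximiser : Σ[ μ ∈ Mixed A ] ((ν : Mixed B) → v ℚ.≤ 𝔼 μ (λ a → 𝔼 ν (payoff a)))
    minimiser : Σ[ ν ∈ Mixed B ] ((μ : Mixed A) → 𝔼 μ (λ a → 𝔼 ν (payoff a)) ℚ.≤ v)

Guess : ℕ → ℕ → Set
Guess n k = Σ[ S ∈ Subset n ] ∣ S ∣ ≤ k

-- The guesses made so far, each with the door at which a treasure was
-- revealed; most recent round first.
History : ℕ → ℕ → Set
History n k = List (Guess n k × Fin n)

answers : ∀ {n k} → History n k → List (Fin n)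
answers = map proj₂

found : ∀ {n k} → History n k → Fin n → ℕ
found h x = length (filter (x ≟_) (answers h))

-- Treasures are indistinguishable: a placement records how many are behind
-- each door.
Placement : ℕ → ℕ → Set
Placement n d = Σ[ p ∈ Vec ℕ n ] Vec.sum p ≡ d

module _ {n d k : ℕ} (p : Placement n d) where

  -- Door x is selected and hides a treasure not yet found.
  Hit : History n k → Guess n k → Fin n → Set
  Hit h S x = x ∈ proj₁ S × found h x < lookup (proj₁ p) x

  hit? : ∀ h S x → Dec (Hit h S x)
  hit? h S x = x ∈? proj₁ S ×-dec found h x <ℕ? lookup (proj₁ p) x

  AllFound : History n k → Set
  AllFound h = ∀ x → found h x ≡ lookup (proj₁ p) x

  allFound? : ∀ h → Dec (AllFound h)
  allFound? h = all? (λ x → found h x ≟ℕ lookup (proj₁ p) x)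

-- A pure strategy determines the searcher's own earlier guesses from the
-- earlier answers, so it only needs the answers (most recent first).
Searcher : ℕ → ℕ → Set
Searcher n k = List (Fin n) → Guess n k

-- The value of reveal is irrelevant when the guess misses.
record Hider (n d k : ℕ) : Set where
  field
    placement : Placement n d
    reveal    : History n k → Guess n k → Fin n
    legal     : ∀ h S → ∃ (Hit placement h S) → Hit placement h S (reveal h S)

module _ {n d k : ℕ} (σ : Searcher n k) (τ : Hider n d k) where
  open Hider τ

  -- The first argument is the number of guesses the searcher has left.
  play : ℕ → History n k → Bool
  play zero    h = does (allFound? placement h)
  play (suc r) h =
    let S = σ (answers h) in
    if does (any? (hit? placement h S)) then play r ((S , reveal h S) ∷ h) else false

  searcherWins : Bool
  searcherWins = play d []

winPayoff : (n d k : ℕ) → Searcher n k → Hider n d k → ℚ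
winPayoff n d k σ τ = if searcherWins σ τ then 1ℚ else 0ℚ

IsSearchGameValue : (n d k : ℕ) → ℚ → Set
IsSearchGameValue n d k = IsValue (winPayoff n d k)

{-# OPTIONS --safe #-}

-- Upper bound: against a uniformly random placement, the answers determine the
-- placement and each guess has at most k answers, so a pure searcher wins
-- against at most k ^ d of the (n + d - 1) C d placements.
--
-- Lower bound: the searcher goes through the doors in a uniformly random order
-- and, apart from the most recent answer, never selects a door twice.  With r
-- guesses left and l distinct doors answered so far, her guess consists of the
-- last answer and k - 1 fresh doors with probability k (l + r) / (n + r), and of
-- k fresh doors otherwise.  She wins whenever every guess contains exactly one
-- door with a treasure left, so that the answers are forced.  Along such a run
-- the factors telescope: their product depends only on n, d, k and the number s of
-- occupied doors, not on the order in which they are met nor on their contents.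
-- Summed over the s! orders it is k ^ d / ((n + d - 1) C d).
module Submission where

open import Defs
open import Algebra.Bundles using (CommutativeMonoid)
open import Data.Bool.Base using (Bool; true; false; if_then_else_)
open import Data.Fin.Base using (Fin; zero; suc)
open import Data.Fin.Properties using (any?) renaming (_≟_ to _≟ᶠ_)
open import Data.Fin.Subset as Subset using (Subset; ⁅_⁆; _∪_; ∣_∣; inside; outside)
open import Data.Fin.Subset.Properties using (∣⊥∣≡0; ∪-identityˡ; x∈⁅x⁆; x∈⁅y⁆⇒x≡y; x∈p∪q⁺; x∈p∪q⁻; ∉⊥)
open import Data.List.Base using (List; []; _∷_; map; _++_; concatMap; length; take; drop; applyUpTo; upTo; allFin; tabulate)
open import Data.List.Membership.Propositional using (_∈_; _∉_; find)
open import Data.List.Membership.Propositional.Properties using (∈-map⁺; ∈-map⁻; ∈-concatMap⁻; ∈-++⁺ˡ; ∈-++⁺ʳ; ∈-++⁻; ∈-allFin)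
open import Data.List.Properties using (map-cong; length-map; length-++; length-upTo; length-tabulate; length-take; take++drop≡id; filter-accept; filter-reject)
open import Data.List.Relation.Binary.Permutation.Propositional using (_↭_; prep; swap; ↭-refl; ↭-sym; ↭-trans; ↭⇒↭ₛ)
open import Data.List.Relation.Binary.Permutation.Propositional.Properties using (↭-length; ∈-resp-↭)
open import Data.List.Relation.Binary.Permutation.Setoid.Properties using (Unique-resp-↭)
open import Data.List.Relation.Unary.All as All using (All; []; _∷_)
open import Data.List.Relation.Unary.All.Properties as All using ()
open import Data.List.Relation.Unary.AllPairs as AllPairs using (AllPairs; []; _∷_)
open import Data.List.Relation.Unary.AllPairs.Properties as AllPairs using ()
open import Data.List.Relation.Unary.Any using (here; there)
open import Data.List.Relation.Unary.Unique.Propositional using (Unique)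
open import Data.List.Relation.Unary.Unique.Propositional.Properties using (allFin⁺; drop⁺)
open import Data.Nat.Base hiding (_/_)
open import Data.Nat.Combinatorics using (_C_; nCn≡1; nCk+nC[k+1]≡[n+1]C[k+1]; nCk≡n!/k![n-k]!; k![n∸k]!∣n!)
open import Data.Nat.DivMod using (m/n*n≡m)
open import Data.Nat.Properties
open import Data.Nat.Tactic.RingSolver using (solve-∀)
open import Data.Product.Base using (∃-syntax; Σ-syntax; ∃; _×_; _,_; proj₁; proj₂)
open import Data.Sum.Base using (_⊎_; inj₁; inj₂)
open import Data.Vec.Base as Vec using (Vec; []; _∷_; lookup; here; there)
open import Data.Vec.Properties using (tabulate∘lookup; tabulate-cong)
open import Function.Base using (_∘_; id)
open import Relation.Binary.PropositionalEquality
open import Relation.Nullary using (¬_; Dec; yes; no; does; contradiction)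
open import Relation.Nullary.Decidable using (dec-true; dec-false)

private variable
  A B : Set

-- Finite sums

∑ : List A → (A → ℕ) → ℕ
∑ []       f = 0
∑ (x ∷ xs) f = f x + ∑ xs f

∑-cong : (xs : List A) {f g : A → ℕ} → (∀ {x} → x ∈ xs → f x ≡ g x) → ∑ xs f ≡ ∑ xs g
∑-cong []       f≡g = refl
∑-cong (x ∷ xs) f≡g = cong₂ _+_ (f≡g (here refl)) (∑-cong xs (f≡g ∘ there))

∑-mono : (xs : List A) {f g : A → ℕ} → (∀ {x} → x ∈ xs → f x ≤ g x) → ∑ xs f ≤ ∑ xs g
∑-mono []       f≤g = z≤n
∑-mono (x ∷ xs) f≤g = +-mono-≤ (f≤g (here refl)) (∑-mono xs (f≤g ∘ there))

∑-term-≤ : {xs : List A} {x : A} (f : A → ℕ) → x ∈ xs → f x ≤ ∑ xs f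
∑-term-≤ f (here refl)          = m≤m+n _ _
∑-term-≤ f (there {x = y} x∈xs) = ≤-trans (∑-term-≤ f x∈xs) (m≤n+m _ (f y))

∑-map : (h : A → B) (xs : List A) (f : B → ℕ) → ∑ (map h xs) f ≡ ∑ xs (f ∘ h)
∑-map h []       f = refl
∑-map h (x ∷ xs) f = cong (f (h x) +_) (∑-map h xs f)

∑-++ : (xs ys : List A) (f : A → ℕ) → ∑ (xs ++ ys) f ≡ ∑ xs f + ∑ ys f
∑-++ []       ys f = refl
∑-++ (x ∷ xs) ys f = trans (cong (f x +_) (∑-++ xs ys f)) (sym (+-assoc (f x) _ _))

∑-concatMap : (g : A → List B) (xs : List A) (f : B → ℕ) → ∑ (concatMap g xs) f ≡ ∑ xs (λ x → ∑ (g x) f)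
∑-concatMap g []       f = refl
∑-concatMap g (x ∷ xs) f = trans (∑-++ (g x) _ f) (cong (∑ (g x) f +_) (∑-concatMap g xs f))

∑-zero : (xs : List A) → ∑ xs (λ _ → 0) ≡ 0
∑-zero []       = refl
∑-zero (x ∷ xs) = ∑-zero xs

∑-one : (xs : List A) → ∑ xs (λ _ → 1) ≡ length xs
∑-one []       = refl
∑-one (x ∷ xs) = cong suc (∑-one xs)

∑-+ : (xs : List A) (f g : A → ℕ) → ∑ xs (λ x → f x + g x) ≡ ∑ xs f + ∑ xs g
∑-+ []       f g = refl
∑-+ (x ∷ xs) f g = trans (cong (f x + g x +_) (∑-+ xs f g)) (interchange (f x) (g x) (∑ xs f) (∑ xs g))
  where
  interchange : ∀ a b c d → (a + b) + (c + d) ≡ (a + c) + (b + d)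
  interchange = solve-∀

∑-*ʳ : (xs : List A) (f : A → ℕ) (c : ℕ) → ∑ xs (λ x → f x * c) ≡ ∑ xs f * c
∑-*ʳ []       f c = refl
∑-*ʳ (x ∷ xs) f c = trans (cong (f x * c +_) (∑-*ʳ xs f c)) (sym (*-distribʳ-+ c (f x) (∑ xs f)))

∑-const : (xs : List A) (c : ℕ) → ∑ xs (λ _ → c) ≡ length xs * c
∑-const []       c = refl
∑-const (x ∷ xs) c = cong (c +_) (∑-const xs c)

∑-swap : (xs : List A) (ys : List B) (f : A → B → ℕ) →
  ∑ xs (λ x → ∑ ys (f x)) ≡ ∑ ys (λ y → ∑ xs (λ x → f x y))
∑-swap []       ys f = sym (∑-zero ys)
∑-swap (x ∷ xs) ys f = trans (cong (∑ ys (f x) +_) (∑-swap xs ys f)) (sym (∑-+ ys (f x) _))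

∑-↭ : {xs ys : List A} (f : A → ℕ) → xs ↭ ys → ∑ xs f ≡ ∑ ys f
∑-↭ f _↭_.refl         = refl
∑-↭ f (prep x π)   = cong (f x +_) (∑-↭ f π)
∑-↭ f (swap x y π) = trans (cong (λ m → f x + (f y + m)) (∑-↭ f π)) (exchange (f x) (f y) _)
  where
  exchange : ∀ a b c → a + (b + c) ≡ b + (a + c)
  exchange = solve-∀
∑-↭ f (_↭_.trans π ρ) = trans (∑-↭ f π) (∑-↭ f ρ)

-- A threshold matters only through the side of `a` on which it falls, so its sum has just two
-- values. The function `f` absorbs the shift by `suc` that `applyUpTo` accumulates in the
-- recursion.
∑-applyUpTo-threshold : ∀ (f g : ℕ → ℕ) a b {x y} →
  (∀ i → i < a → g (f i) ≡ x) → (∀ i → a ≤ i → g (f i) ≡ y) →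
  ∑ (applyUpTo f (a + b)) g ≡ a * x + b * y
∑-applyUpTo-threshold f g zero    zero        gx gy = refl
∑-applyUpTo-threshold f g zero    (suc b) {x} gx gy =
  cong₂ _+_ (gy 0 z≤n) (∑-applyUpTo-threshold (f ∘ suc) g 0 b {x} (λ _ ()) (λ _ _ → gy _ z≤n))
∑-applyUpTo-threshold f g (suc a) b {x} {y} gx gy = begin
  g (f 0) + ∑ (applyUpTo (f ∘ suc) (a + b)) g
    ≡⟨ cong₂ _+_ (gx 0 z<s) (∑-applyUpTo-threshold (f ∘ suc) g a b (λ i → gx (suc i) ∘ s<s) (λ i → gy (suc i) ∘ s≤s)) ⟩
  x + (a * x + b * y)
    ≡⟨ +-assoc x _ _ ⟨
  suc a * x + b * y ∎
  where open ≡-Reasoning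

-- Orderings of a list

picks : List A → List (A × List A)
picks []       = []
picks (x ∷ xs) = (x , xs) ∷ map (λ (u , ys) → u , x ∷ ys) (picks xs)

picks-↭ : (xs : List A) {u : A} {ys : List A} → (u , ys) ∈ picks xs → xs ↭ u ∷ ys
picks-↭ (x ∷ xs) (here refl) = ↭-refl
picks-↭ (x ∷ xs) (there u∈)  with ∈-map⁻ _ u∈
... | (u , ys) , u∈′ , refl = ↭-trans (prep x (picks-↭ xs u∈′)) (swap x u ↭-refl)

∑-picks-head : (xs : List A) (f : A → ℕ) → ∑ (picks xs) (f ∘ proj₁) ≡ ∑ xs f
∑-picks-head []       f = refl
∑-picks-head (x ∷ xs) f = cong (f x +_) (trans (∑-map _ (picks xs) _) (∑-picks-head xs f))

-- Only meaningful when the first argument is the length of the list.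
orders : ℕ → List A → List (List A)
orders zero    xs = [] ∷ []
orders (suc m) xs = concatMap (λ (u , ys) → map (u ∷_) (orders m ys)) (picks xs)

perms : List A → List (List A)
perms xs = orders (length xs) xs

-- Conditioning on the first door: once it is fixed, the rest runs through all orders of the
-- remaining doors. The empty list is excluded because it has one order but no first element.
∑-perms : (xs : List A) (f : List A → ℕ) → 0 < length xs →
  ∑ (perms xs) f ≡ ∑ (picks xs) (λ (u , ys) → ∑ (perms ys) (f ∘ (u ∷_)))
∑-perms xs@(x ∷ xs′) f _ = trans (∑-concatMap (λ (u , ys) → map (u ∷_) (orders (length xs′) ys)) (picks xs) f) (∑-cong (picks xs) pick)
  where
  pick : ∀ {(u , ys) : _ × _} → (u , ys) ∈ picks xs →
    ∑ (map (u ∷_) (orders (length xs′) ys)) f ≡ ∑ (perms ys) (f ∘ (u ∷_))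
  -- The recursion of `orders` is measured by a number, which has to be recognised as `length ys`
  -- before `perms ys` appears.
  pick {u , ys} u∈ rewrite suc-injective (↭-length (picks-↭ xs u∈)) = ∑-map (u ∷_) (perms ys) f

orders-↭ : ∀ m (xs : List A) → length xs ≡ m → ∀ {ys} → ys ∈ orders m xs → ys ↭ xs
orders-↭ zero    []       _  (here refl) = ↭-refl
orders-↭ (suc m) (x ∷ xs) eq ys∈ with find (∈-concatMap⁻ (λ (u , zs) → map (u ∷_) (orders m zs)) {xs = picks (x ∷ xs)} ys∈)
... | (u , zs) , u∈ , ys∈′ with ∈-map⁻ (u ∷_) ys∈′
... | ws , ws∈ , refl =
  ↭-trans (prep u (orders-↭ m zs (suc-injective (trans (sym (↭-length (picks-↭ (x ∷ xs) u∈))) eq)) ws∈))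
          (↭-sym (picks-↭ (x ∷ xs) u∈))

length-perms : (xs : List A) → length (perms xs) ≡ length xs !
length-perms xs = go (length xs) xs refl
  where
  open ≡-Reasoning
  go : ∀ m (xs : List A) → length xs ≡ m → length (perms xs) ≡ m !
  go zero    []          _  = refl
  go (suc m) xs@(_ ∷ _) eq = begin
    length (perms xs)                              ≡⟨ ∑-one (perms xs) ⟨
    ∑ (perms xs) (λ _ → 1)                         ≡⟨ ∑-perms xs _ z<s ⟩
    ∑ (picks xs) (λ (u , ys) → ∑ (perms ys) (λ _ → 1))
      ≡⟨ ∑-cong (picks xs) (λ {(u , ys)} u∈ → trans (∑-one (perms ys))
           (go m ys (suc-injective (trans (sym (↭-length (picks-↭ xs u∈))) eq)))) ⟩
    ∑ (picks xs) (λ _ → m !)                       ≡⟨ ∑-picks-head xs (λ _ → m !) ⟩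
    ∑ xs (λ _ → m !)                               ≡⟨ ∑-const xs (m !) ⟩
    length xs * m !                                ≡⟨ cong (_* m !) eq ⟩
    suc m !                                        ∎

-- Counting the winning seeds

-- The falling factorial `m (m - 1) ⋯ (m - j + 1)`, which is 0 for `j > m`.
fall : ℕ → ℕ → ℕ
fall m       zero    = 1
fall zero    (suc j) = 0
fall (suc m) (suc j) = suc m * fall m j

fall-! : ∀ a m → fall (a + m) a * m ! ≡ (a + m) !
fall-! zero    m = *-identityˡ (m !)
fall-! (suc a) m = trans (*-assoc (suc (a + m)) (fall (a + m) a) (m !)) (cong (suc (a + m) *_) (fall-! a m))

-- The threshold consulted with r guesses left ranges over n + r values, so that
-- comparing it with k * (l + r) realises the probability k (l + r) / (n + r).
thresholds : ℕ → (r : ℕ) → List (Vec ℕ r)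
thresholds n zero    = [] ∷ []
thresholds n (suc r) = concatMap (λ t → map (t ∷_) (thresholds n r)) (upTo (n + suc r))

∑-thresholds : ∀ n r (f : Vec ℕ (suc r) → ℕ) →
  ∑ (thresholds n (suc r)) f ≡ ∑ (upTo (n + suc r)) (λ t → ∑ (thresholds n r) (f ∘ (t ∷_)))
∑-thresholds n r f = trans (∑-concatMap _ (upTo (n + suc r)) f)
                           (∑-cong (upTo (n + suc r)) (λ {t} _ → ∑-map (t ∷_) (thresholds n r) f))

-- Exchanging the sums fixes the next threshold before anything is summed over the orders. Of its
-- `n + suc r` values, `E` lie below `E` and the others do not.
∑-∑-thresholds : ∀ {A : Set} {n r} (xs : List A) (f : A → Vec ℕ (suc r) → ℕ) E {v w} → E ≤ n + suc r →
  (∀ t → t < E → ∑ xs (λ x → ∑ (thresholds n r) (λ ts → f x (t ∷ ts))) ≡ v) →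
  (∀ t → E ≤ t → ∑ xs (λ x → ∑ (thresholds n r) (λ ts → f x (t ∷ ts))) ≡ w) →
  ∑ xs (λ x → ∑ (thresholds n (suc r)) (f x)) ≡ E * v + (n + suc r ∸ E) * w
∑-∑-thresholds {n = n} {r} xs f E {v} {w} E≤ below above = begin
  ∑ xs (λ x → ∑ (thresholds n (suc r)) (f x))
    ≡⟨ ∑-cong xs (λ _ → ∑-thresholds n r _) ⟩
  ∑ xs (λ x → ∑ (upTo (n + suc r)) (λ t → ∑ (thresholds n r) (λ ts → f x (t ∷ ts))))
    ≡⟨ ∑-swap xs (upTo (n + suc r)) _ ⟩
  ∑ (upTo (n + suc r)) given
    ≡⟨ cong (λ m → ∑ (upTo m) given) (m+[n∸m]≡n E≤) ⟨
  ∑ (upTo (E + (n + suc r ∸ E))) given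
    ≡⟨ ∑-applyUpTo-threshold id given E (n + suc r ∸ E) below above ⟩
  E * v + (n + suc r ∸ E) * w ∎
  where
  open ≡-Reasoning
  given : ℕ → ℕ
  given t = ∑ xs (λ x → ∑ (thresholds n r) (λ ts → f x (t ∷ ts)))

-- There are `(n + 1) ⋯ (n + r)` threshold vectors; together with the `n !` orders of the doors, the
-- number of seeds becomes a single factorial.
length-thresholds : ∀ n r → n ! * length (thresholds n r) ≡ (n + r) !
length-thresholds n zero    = trans (*-identityʳ (n !)) (cong _! (sym (+-identityʳ n)))
length-thresholds n (suc r) = begin
  n ! * length (thresholds n (suc r))               ≡⟨ cong (n ! *_) len ⟩
  n ! * ((n + suc r) * length (thresholds n r))     ≡⟨ regroup (n !) (n + suc r) _ ⟩
  (n + suc r) * (n ! * length (thresholds n r))     ≡⟨ cong ((n + suc r) *_) (length-thresholds n r) ⟩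
  (n + suc r) * (n + r) !                           ≡⟨ cong (_* (n + r) !) (+-suc n r) ⟩
  suc (n + r) !                                     ≡⟨ cong _! (+-suc n r) ⟨
  (n + suc r) !                                     ∎
  where
  open ≡-Reasoning
  regroup : ∀ a b c → a * (b * c) ≡ b * (a * c)
  regroup = solve-∀
  len : length (thresholds n (suc r)) ≡ (n + suc r) * length (thresholds n r)
  len = begin
    length (thresholds n (suc r))                              ≡⟨ ∑-one (thresholds n (suc r)) ⟨
    ∑ (thresholds n (suc r)) (λ _ → 1)                         ≡⟨ ∑-thresholds n r _ ⟩
    ∑ (upTo (n + suc r)) (λ t → ∑ (thresholds n r) (λ _ → 1))  ≡⟨ ∑-const (upTo (n + suc r)) _ ⟩
    length (upTo (n + suc r)) * ∑ (thresholds n r) (λ _ → 1)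
      ≡⟨ cong₂ _*_ (length-upTo (n + suc r)) (∑-one (thresholds n r)) ⟩
    (n + suc r) * length (thresholds n r)                      ∎

ifZero : ℕ → ℕ → ℕ → ℕ
ifZero zero    x y = x
ifZero (suc _) x y = y

module Count {A : Set} (p : A → ℕ) where

  -- In a complete run `support` is the number of answers at new doors and `excess` the number of
  -- answers that repeat a door.
  zeros support excess : List A → ℕ
  zeros   xs = ∑ xs (λ u → ifZero (p u) 1 0)
  support xs = ∑ xs (λ u → ifZero (p u) 0 1)
  excess  xs = ∑ xs (λ u → pred (p u))

  zeros+support : ∀ xs → zeros xs + support xs ≡ length xs
  zeros+support xs = trans (sym (∑-+ xs _ _)) (trans (∑-cong xs (λ {u} _ → one (p u))) (∑-one xs))
    where
    one : ∀ m → ifZero m 1 0 + ifZero m 0 1 ≡ 1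
    one zero    = refl
    one (suc _) = refl

  support+excess : ∀ xs → support xs + excess xs ≡ ∑ xs p
  support+excess xs = trans (sym (∑-+ xs _ _)) (∑-cong xs (λ {u} _ → total (p u)))
    where
    total : ∀ m → ifZero m 0 1 + pred m ≡ m
    total zero    = refl
    total (suc _) = refl

  support≡0⇒excess≡0 : ∀ xs → support xs ≡ 0 → excess xs ≡ 0
  support≡0⇒excess≡0 []       _  = refl
  support≡0⇒excess≡0 (u ∷ xs) eq with p u
  ... | zero = support≡0⇒excess≡0 xs eq

  length>0 : ∀ xs {z} → suc z ≤ zeros xs → 0 < length xs
  length>0 (_ ∷ _) _ = z<s

  -- Indicators that none, respectively exactly one, of the first j doors is
  -- occupied, times the value of κ at the remaining doors.
  allEmpty : ℕ → (List A → ℕ) → List A → ℕ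
  allEmpty zero    κ xs       = κ xs
  allEmpty (suc j) κ []       = 0
  allEmpty (suc j) κ (u ∷ xs) = ifZero (p u) (allEmpty j κ xs) 0

  oneFull : ℕ → (A → List A → ℕ) → List A → ℕ
  oneFull zero    κ xs       = 0
  oneFull (suc j) κ []       = 0
  oneFull (suc j) κ (u ∷ xs) = ifZero (p u) (oneFull j κ xs) (allEmpty j (κ u) xs)

  -- Which doors are tested now does not depend on the later thresholds, so the sum over those
  -- passes into the continuation.
  ∑-allEmpty : ∀ {B : Set} (ts : List B) (κ : B → List A → ℕ) j xs →
    ∑ ts (λ t → allEmpty j (κ t) xs) ≡ allEmpty j (λ ys → ∑ ts (λ t → κ t ys)) xs
  ∑-allEmpty ts κ zero    xs       = refl
  ∑-allEmpty ts κ (suc j) []       = ∑-zero ts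
  ∑-allEmpty ts κ (suc j) (u ∷ xs) with p u
  ... | zero  = ∑-allEmpty ts κ j xs
  ... | suc _ = ∑-zero ts

  ∑-oneFull : ∀ {B : Set} (ts : List B) (κ : B → A → List A → ℕ) j xs →
    ∑ ts (λ t → oneFull j (κ t) xs) ≡ oneFull j (λ u ys → ∑ ts (λ t → κ t u ys)) xs
  ∑-oneFull ts κ zero    xs       = ∑-zero ts
  ∑-oneFull ts κ (suc j) []       = ∑-zero ts
  ∑-oneFull ts κ (suc j) (u ∷ xs) with p u
  ... | zero  = ∑-oneFull ts κ j xs
  ... | suc _ = ∑-allEmpty ts (λ t → κ t u) j xs

  -- The shape of the induction hypothesis. The orders of the occupied doors among themselves and of
  -- the empty doors among themselves are split off as factorials, and what remains is a constant
  -- `K` common to all lists with the same `s` and `x`. `Z` is the stock of empty doors that the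
  -- remaining guesses may use up.
  HasCount : (List A → ℕ) → (K Z s x : ℕ) → Set
  HasCount κ K Z s x = ∀ xs → support xs ≡ s → excess xs ≡ x → Z ≤ zeros xs →
    ∑ (perms xs) κ ≡ K * (s ! * zeros xs !)

  -- Any of the `suc z` empty doors may come first, and this factor turns `z !` into `(suc z) !`.
  -- Selecting empty doors therefore leaves `K` unchanged and only draws `j` doors from the stock.
  allEmpty-count : ∀ j κ {K Z s x} → HasCount κ K Z s x → HasCount (allEmpty j κ) K (j + Z) s x
  allEmpty-count zero    κ H = H
  allEmpty-count (suc j) κ {K} {Z} {s} {x} H xs s≡ x≡ Z≤ with zeros xs in z≡
  ... | suc z = begin
    ∑ (perms xs) (allEmpty (suc j) κ)
      ≡⟨ ∑-perms xs _ (length>0 xs (≤-reflexive (sym z≡))) ⟩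
    ∑ (picks xs) (λ (u , ys) → ∑ (perms ys) (allEmpty (suc j) κ ∘ (u ∷_)))
      ≡⟨ ∑-cong (picks xs) (λ u∈ → first _ _ (picks-↭ xs u∈)) ⟩
    ∑ (picks xs) (λ (u , ys) → ifZero (p u) 1 0 * (K * (s ! * z !)))
      ≡⟨ ∑-*ʳ (picks xs) _ _ ⟩
    ∑ (picks xs) (λ (u , ys) → ifZero (p u) 1 0) * (K * (s ! * z !))
      ≡⟨ cong (_* (K * (s ! * z !))) (trans (∑-picks-head xs _) z≡) ⟩
    suc z * (K * (s ! * z !))
      ≡⟨ rearrange (suc z) K (s !) (z !) ⟩
    K * (s ! * (suc z * z !)) ∎
    where
    open ≡-Reasoning
    rearrange : ∀ a b c d → a * (b * (c * d)) ≡ b * (c * (a * d))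
    rearrange = solve-∀
    first : ∀ u ys → xs ↭ u ∷ ys →
      ∑ (perms ys) (allEmpty (suc j) κ ∘ (u ∷_)) ≡ ifZero (p u) 1 0 * (K * (s ! * z !))
    first u ys π with p u | ∑-↭ (λ u → ifZero (p u) 0 1) π | ∑-↭ (λ u → pred (p u)) π | ∑-↭ (λ u → ifZero (p u) 1 0) π
    ... | suc _ | _ | _ | _ = ∑-zero (perms ys)
    ... | zero | σ | ξ | ζ = trans
      (allEmpty-count j κ {K} H ys (trans (sym σ) s≡) (trans (sym ξ) x≡) (≤-trans (≤-pred Z≤) (≤-reflexive (sym zys))))
      (trans (cong (λ m → K * (s ! * m !)) zys) (sym (*-identityˡ _)))
      where
      zys : zeros ys ≡ z
      zys = suc-injective (trans (sym ζ) z≡)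

  -- The occupied door may stand at any of the `j` selected places, whence the factor `j`; that it
  -- may be any of the `suc s` occupied doors completes `s !` to `suc s !`. The hypothesis asks for
  -- one `K` however the excess `a` is split between the door `u` and the remaining doors, so the
  -- contents of `u` do not matter.
  oneFull-count : ∀ j κ {K Z s a} →
    (∀ u → p u ≢ 0 → ∀ x → pred (p u) + x ≡ a → HasCount (κ u) K Z s x) →
    HasCount (oneFull j κ) (j * K) (j + Z) (suc s) a
  oneFull-count zero    κ H xs _ _ _ = ∑-zero (perms xs)
  oneFull-count (suc j) κ {K} {Z} {s} {a} H xs s≡ x≡ Z≤ with zeros xs in z≡
  ... | suc z = begin
    ∑ (perms xs) (oneFull (suc j) κ)
      ≡⟨ ∑-perms xs _ (length>0 xs (≤-reflexive (sym z≡))) ⟩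
    ∑ (picks xs) (λ (u , ys) → ∑ (perms ys) (oneFull (suc j) κ ∘ (u ∷_)))
      ≡⟨ ∑-cong (picks xs) (λ u∈ → first _ _ (picks-↭ xs u∈)) ⟩
    ∑ (picks xs) (λ (u , ys) → ifZero (p u) 1 0 * V₀ + ifZero (p u) 0 1 * V₁)
      ≡⟨ ∑-picks-head xs (λ u → ifZero (p u) 1 0 * V₀ + ifZero (p u) 0 1 * V₁) ⟩
    ∑ xs (λ u → ifZero (p u) 1 0 * V₀ + ifZero (p u) 0 1 * V₁)
      ≡⟨ ∑-+ xs _ _ ⟩
    ∑ xs (λ u → ifZero (p u) 1 0 * V₀) + ∑ xs (λ u → ifZero (p u) 0 1 * V₁)
      ≡⟨ cong₂ _+_ (∑-*ʳ xs _ V₀) (∑-*ʳ xs _ V₁) ⟩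
    zeros xs * V₀ + support xs * V₁
      ≡⟨ cong₂ (λ a b → a * V₀ + b * V₁) z≡ s≡ ⟩
    suc z * V₀ + suc s * V₁
      ≡⟨ rearrange (suc z) (suc s) j K (s !) (z !) ⟩
    suc j * K * (suc s ! * (suc z) !) ∎
    where
    open ≡-Reasoning
    V₀ = j * K * (suc s ! * z !)
    V₁ = K * (s ! * (suc z) !)
    rearrange : ∀ m l j K c d →
      m * (j * K * (l * c * d)) + l * (K * (c * (m * d))) ≡ (K + j * K) * (l * c * (m * d))
    rearrange = solve-∀
    first : ∀ u ys → xs ↭ u ∷ ys →
      ∑ (perms ys) (oneFull (suc j) κ ∘ (u ∷_)) ≡ ifZero (p u) 1 0 * V₀ + ifZero (p u) 0 1 * V₁
    first u ys π with p u in eq | ∑-↭ (λ u → ifZero (p u) 0 1) π | ∑-↭ (λ u → pred (p u)) π | ∑-↭ (λ u → ifZero (p u) 1 0) π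
    ... | suc e | σ | ξ | ζ = trans
      (allEmpty-count j (κ u) {K} (H u (λ eq′ → contradiction (trans (sym eq) eq′) λ ()) (excess ys)
          (trans (cong (λ m → pred m + excess ys) eq) (trans (sym ξ) x≡)))
        ys (suc-injective (trans (sym σ) s≡)) refl
        (≤-trans (≤-trans (n≤1+n _) Z≤) (≤-reflexive (trans (sym z≡) ζ))))
      (trans (cong (λ m → K * (s ! * m !)) (trans (sym ζ) z≡)) (sym (+-identityʳ V₁)))
    ... | zero | σ | ξ | ζ = trans
      (oneFull-count j κ {K} H ys (trans (sym σ) s≡) (trans (sym ξ) x≡) (≤-trans (≤-pred Z≤) (≤-reflexive (sym zys))))
      (trans (cong (λ m → j * K * (suc s ! * m !)) zys) (sym (trans (+-identityʳ _) (+-identityʳ _))))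
      where
      zys : zeros ys ≡ z
      zys = suc-injective (trans (sym ζ) z≡)

  module _ (n k-1 : ℕ) where
    private k = suc k-1

    -- The indicator of a run with forced answers: r guesses are left, l distinct
    -- doors were answered, c treasures remain behind the last answer, and xs lists
    -- the doors not selected yet.
    good : (r l c : ℕ) → List A → Vec ℕ r → ℕ
    good zero    l zero    xs []       = ifZero (support xs) 1 0
    good zero    l (suc c) xs []       = 0
    good (suc r) l zero    xs (t ∷ ts) =
      oneFull (if does (t <? k * (l + suc r)) then k-1 else k) (λ u ys → good r (suc l) (pred (p u)) ys ts) xs
    -- A guess without the last answer abandons that door for good, and with it the treasures still
    -- there, so such a run counts 0.
    good (suc r) l (suc c) xs (t ∷ ts) =
      if does (t <? k * (l + suc r)) then allEmpty k-1 (λ ys → good r l c ys ts) xs else 0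

    -- Of the r treasures left, s are found at new doors and a are repeats.  A repeat
    -- is allowed by k (l + r) thresholds; a new door is selected in
    -- (k - 1) E + k (n + r - E) = k (n - l) ways, where E = k (l + r).  A repeat
    -- lowers l + r and a new door lowers n - l = w, whence the falling factorials.
    good-count : ∀ r l w c {a s} → l + w ≡ n → a + s ≡ r → k * (l + r) ≤ n → ∀ x → c + x ≡ a →
      HasCount (λ xs → ∑ (thresholds n r) (good r l c xs)) (k ^ r * fall (l + r) a * fall w s) (k * r) s x
    good-count zero l w c {zero} {zero} lw refl kn x cx xs s≡ x≡ Z≤ rewrite m+n≡0⇒m≡0 c cx = begin
      ∑ (perms xs) (λ ys → ifZero (support ys) 1 0 + 0)
        ≡⟨ ∑-cong (perms xs) (λ {ys} ys∈ → cong (λ m → ifZero m 1 0 + 0)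
             (trans (∑-↭ _ (orders-↭ (length xs) xs refl ys∈)) s≡)) ⟩
      ∑ (perms xs) (λ _ → 1)       ≡⟨ ∑-one (perms xs) ⟩
      length (perms xs)            ≡⟨ length-perms xs ⟩
      length xs !                  ≡⟨ cong _! (zeros+support xs) ⟨
      (zeros xs + support xs) !    ≡⟨ cong (λ m → (zeros xs + m) !) s≡ ⟩
      (zeros xs + 0) !             ≡⟨ cong _! (+-identityʳ (zeros xs)) ⟩
      zeros xs !                   ≡⟨ trans (+-identityʳ _) (+-identityʳ _) ⟨
      1 * (1 * zeros xs !)         ∎
      where open ≡-Reasoning
    -- With no occupied door left and nothing behind the last answer, no treasure remains, although
    -- `suc r` should.
    good-count (suc r) l w zero {a} {zero} lw as kn x cx xs s≡ x≡ Z≤ =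
      contradiction (trans (sym as) (trans (+-identityʳ a) (trans (sym cx) (trans (sym x≡) (support≡0⇒excess≡0 xs s≡))))) λ ()
    -- `w = 0` means that all `n` doors have been answered, so `l = n`, against
    -- `k * (l + suc r) ≤ n`.
    good-count (suc r) l zero zero {a} {suc s} lw as kn x cx xs s≡ x≡ Z≤ =
      contradiction (≤-trans (≤-trans (m≤m+n (l + suc r) _) kn) (≤-reflexive (trans (sym lw) (+-identityʳ l)))) (m+1+n≰m l)
    good-count (suc r) l (suc w) zero {a} {suc s} lw as kn x cx xs s≡ x≡ Z≤ = begin
      ∑ (perms xs) (λ ys → ∑ (thresholds n (suc r)) (good (suc r) l 0 ys))
        ≡⟨ ∑-∑-thresholds (perms xs) (good (suc r) l 0) E E≤ stay leave ⟩
      E * (k-1 * K * V) + F * (k * K * V)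
        ≡⟨ collect E F k-1 K V ⟩
      (E * k-1 + F * k) * K * V
        ≡⟨ cong (λ m → m * K * V) weights ⟩
      k * suc w * (k ^ r * fall (suc l + r) a * fall w s) * V
        ≡⟨ cong (λ m → k * suc w * (k ^ r * fall m a * fall w s) * V) (sym (+-suc l r)) ⟩
      k * suc w * (k ^ r * fall (l + suc r) a * fall w s) * V
        ≡⟨ regroup k (suc w) (k ^ r) (fall (l + suc r) a) (fall w s) V ⟩
      k ^ suc r * fall (l + suc r) a * fall (suc w) (suc s) * V ∎
      where
      open ≡-Reasoning
      E = k * (l + suc r)
      F = n + suc r ∸ E
      K = k ^ r * fall (suc l + r) a * fall w s
      V = suc s ! * zeros xs !
      E≤ = ≤-trans kn (m≤m+n n (suc r))
      κ : A → List A → ℕ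
      κ u ys = ∑ (thresholds n r) (good r (suc l) (pred (p u)) ys)
      IH : ∀ u → p u ≢ 0 → ∀ x → pred (p u) + x ≡ a → HasCount (κ u) K (k * r) s x
      IH u _ = good-count r (suc l) w (pred (p u)) (trans (sym (+-suc l w)) lw)
        (suc-injective (trans (sym (+-suc a s)) as)) (≤-trans (≤-reflexive (cong (k *_) (sym (+-suc l r)))) kn)
      Z≤′ = ≤-trans (≤-reflexive (sym (*-suc k r))) Z≤
      stay : ∀ t → t < E → ∑ (perms xs) (λ ys → ∑ (thresholds n r) (λ ts → good (suc r) l 0 ys (t ∷ ts))) ≡ k-1 * K * V
      stay t t<E rewrite dec-true (t <? E) t<E = trans
        (∑-cong (perms xs) (λ _ → ∑-oneFull (thresholds n r) _ k-1 _))
        (oneFull-count k-1 κ {K} IH xs s≡ (trans x≡ cx) (≤-trans (n≤1+n _) Z≤′))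
      leave : ∀ t → E ≤ t → ∑ (perms xs) (λ ys → ∑ (thresholds n r) (λ ts → good (suc r) l 0 ys (t ∷ ts))) ≡ k * K * V
      leave t E≤t rewrite dec-false (t <? E) (≤⇒≯ E≤t) = trans
        (∑-cong (perms xs) (λ {ys} _ → ∑-oneFull (thresholds n r) (λ ts u ys → good r (suc l) (pred (p u)) ys ts) k ys))
        (oneFull-count k κ {K} IH xs s≡ (trans x≡ cx) Z≤′)
      -- This is where the bias `E` comes from. Adding `E` makes the left side
      -- `k (E + F) = k (n + suc r)`, and removing `E = k (l + suc r)` again leaves `k` times the
      -- number `suc w = n - l` of doors not yet answered.
      weights : E * k-1 + F * k ≡ k * suc w
      weights = +-cancelʳ-≡ E _ _ (begin
        E * k-1 + F * k + E      ≡⟨ expand E F k-1 ⟩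
        k * (E + F)              ≡⟨ cong (k *_) (m+[n∸m]≡n E≤) ⟩
        k * (n + suc r)          ≡⟨ cong (λ m → k * (m + suc r)) lw ⟨
        k * (l + suc w + suc r)  ≡⟨ shuffle k l (suc w) (suc r) ⟩
        k * suc w + E            ∎)
        where
        expand : ∀ E F k-1 → E * k-1 + F * suc k-1 + E ≡ suc k-1 * (E + F)
        expand = solve-∀
        shuffle : ∀ k l w r → k * (l + w + r) ≡ k * w + k * (l + r)
        shuffle = solve-∀
      collect : ∀ E F k-1 K V → E * (k-1 * K * V) + F * (suc k-1 * K * V) ≡ (E * k-1 + F * suc k-1) * K * V
      collect = solve-∀
      regroup : ∀ k w a b c V → k * w * (a * b * c) * V ≡ k * a * b * (w * c) * V
      regroup = solve-∀
    good-count (suc r) l w (suc c) {suc a} {s} lw as kn x cx xs s≡ x≡ Z≤ = begin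
      ∑ (perms xs) (λ ys → ∑ (thresholds n (suc r)) (good (suc r) l (suc c) ys))
        ≡⟨ ∑-∑-thresholds (perms xs) (good (suc r) l (suc c)) E E≤ stay leave ⟩
      E * (K * V) + F * 0
        ≡⟨ regroup k (l + suc r) F (k ^ r) (fall (l + r) a) (fall w s) V ⟩
      k ^ suc r * ((l + suc r) * fall (l + r) a) * fall w s * V
        ≡⟨ cong (λ m → k ^ suc r * m * fall w s * V) fall-suc ⟩
      k ^ suc r * fall (l + suc r) (suc a) * fall w s * V ∎
      where
      open ≡-Reasoning
      E = k * (l + suc r)
      F = n + suc r ∸ E
      K = k ^ r * fall (l + r) a * fall w s
      V = s ! * zeros xs !
      E≤ = ≤-trans kn (m≤m+n n (suc r))
      Z≤′ = ≤-trans (≤-reflexive (sym (*-suc k r))) Z≤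
      stay : ∀ t → t < E → ∑ (perms xs) (λ ys → ∑ (thresholds n r) (λ ts → good (suc r) l (suc c) ys (t ∷ ts))) ≡ K * V
      stay t t<E rewrite dec-true (t <? E) t<E = trans
        (∑-cong (perms xs) (λ _ → ∑-allEmpty (thresholds n r) _ k-1 _))
        (allEmpty-count k-1 _ {K}
          (good-count r l w c lw (suc-injective as)
            (≤-trans (*-monoʳ-≤ k (+-monoʳ-≤ l (n≤1+n r))) kn) x (suc-injective cx))
          xs s≡ x≡ (≤-trans (n≤1+n _) Z≤′))
      leave : ∀ t → E ≤ t → ∑ (perms xs) (λ ys → ∑ (thresholds n r) (λ ts → good (suc r) l (suc c) ys (t ∷ ts))) ≡ 0
      leave t E≤t rewrite dec-false (t <? E) (≤⇒≯ E≤t) =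
        trans (∑-cong (perms xs) (λ _ → ∑-zero (thresholds n r))) (∑-zero (perms xs))
      fall-suc : (l + suc r) * fall (l + r) a ≡ fall (l + suc r) (suc a)
      fall-suc rewrite +-suc l r = refl
      regroup : ∀ k m F a b c V → k * m * (a * b * c * V) + F * 0 ≡ k * a * (m * b) * c * V
      regroup = solve-∀

    -- The first guess has no previous answer to include, so it consumes no threshold: `d` guesses
    -- take `d-1` thresholds.
    goodSeed : (d-1 : ℕ) → List A → Vec ℕ d-1 → ℕ
    goodSeed d-1 xs ts = oneFull k (λ u ys → good d-1 1 (pred (p u)) ys ts) xs

  -- The factorials of the orders complete the falling factorials: `fall d a` and `suc s !` give
  -- `d !` because `a + suc s = d`, while `fall n-1 s` and `z !` give `n-1 !` because `s + z = n-1`.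
  -- Thus `a`, `s` and `z` drop out and every placement has the same count.
  goodSeed-count : ∀ n-1 d-1 k-1 → let n = suc n-1; d = suc d-1; k = suc k-1 in
    ∀ xs → length xs ≡ n → ∑ xs p ≡ d → d + k * d ≤ n →
    ∑ (perms xs) (λ ys → ∑ (thresholds n d-1) (goodSeed n k-1 d-1 ys)) ≡ k ^ d * (d ! * n-1 !)
  goodSeed-count n-1 d-1 k-1 xs len tot N≤ with support xs in s≡
  ... | zero  = contradiction (begin
      suc d-1                     ≡⟨ tot ⟨
      ∑ xs p                      ≡⟨ support+excess xs ⟨
      support xs + excess xs      ≡⟨ cong₂ _+_ s≡ (support≡0⇒excess≡0 xs s≡) ⟩
      0                           ∎) λ ()
    where open ≡-Reasoning
  ... | suc s = begin
    ∑ (perms xs) (λ ys → ∑ (thresholds n d-1) (goodSeed n k-1 d-1 ys))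
      ≡⟨ ∑-cong (perms xs) (λ {ys} _ →
           ∑-oneFull (thresholds n d-1) (λ ts u zs → good n k-1 d-1 1 (pred (p u)) zs ts) k ys) ⟩
    ∑ (perms xs) (oneFull k (λ u zs → ∑ (thresholds n d-1) (good n k-1 d-1 1 (pred (p u)) zs)))
      ≡⟨ oneFull-count k _ {K}
           (λ u _ → good-count n k-1 d-1 1 n-1 (pred (p u)) refl a+s≡d-1 (≤-trans (m≤n+m (k * d) d) N≤))
           xs s≡ refl (≤-trans (≤-reflexive (sym (*-suc k d-1))) kd≤zeros) ⟩
    k * (k ^ d-1 * fall d a * fall n-1 s) * (suc s ! * z !)
      ≡⟨ regroup k (k ^ d-1) (fall d a) (fall n-1 s) (suc s !) (z !) ⟩
    k ^ d * ((fall d a * suc s !) * (fall n-1 s * z !))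
      ≡⟨ cong₂ (λ m m′ → k ^ d * ((fall m a * suc s !) * (fall m′ s * z !))) (sym a+s≡d) (sym s+z≡n-1) ⟩
    k ^ d * ((fall (a + suc s) a * suc s !) * (fall (s + z) s * z !))
      ≡⟨ cong₂ (λ m m′ → k ^ d * (m * m′)) (fall-! a (suc s)) (fall-! s z) ⟩
    k ^ d * ((a + suc s) ! * (s + z) !)
      ≡⟨ cong₂ (λ m m′ → k ^ d * (m ! * m′ !)) a+s≡d s+z≡n-1 ⟩
    k ^ d * (d ! * n-1 !) ∎
    where
    open ≡-Reasoning
    n = suc n-1
    d = suc d-1
    k = suc k-1
    a = excess xs
    z = zeros xs
    K = k ^ d-1 * fall d a * fall n-1 s
    a+s≡d : a + suc s ≡ d
    a+s≡d = trans (+-comm a (suc s)) (trans (cong (_+ a) (sym s≡)) (trans (support+excess xs) tot))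
    a+s≡d-1 : a + s ≡ d-1
    a+s≡d-1 = suc-injective (trans (sym (+-suc a s)) a+s≡d)
    z+s≡n : z + suc s ≡ n
    z+s≡n = trans (cong (z +_) (sym s≡)) (trans (zeros+support xs) len)
    s+z≡n-1 : s + z ≡ n-1
    s+z≡n-1 = suc-injective (trans (+-comm (suc s) z) z+s≡n)
    -- At most `d` doors are occupied, so `d + k * d ≤ n` leaves enough empty doors for `d` guesses
    -- of `k` doors.
    kd≤zeros : k * d ≤ z
    kd≤zeros = +-cancelˡ-≤ d _ _ (≤-trans N≤ (≤-trans (≤-reflexive (trans (sym z+s≡n) (+-comm z (suc s))))
      (+-monoˡ-≤ z (≤-trans (m≤n+m (suc s) a) (≤-reflexive a+s≡d)))))
    regroup : ∀ k x f g u v → k * (x * f * g) * (u * v) ≡ k * x * ((f * u) * (g * v))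
    regroup = solve-∀

-- The searcher's strategy

indicator : Bool → ℕ
indicator b = if b then 1 else 0

∣⁅x⁆∪S∣≤1+∣S∣ : ∀ {n} (x : Fin n) (S : Subset n) → ∣ ⁅ x ⁆ ∪ S ∣ ≤ suc ∣ S ∣
∣⁅x⁆∪S∣≤1+∣S∣ zero    (inside  ∷ S) = s≤s (≤-trans (≤-reflexive (cong ∣_∣ (∪-identityˡ S))) (n≤1+n ∣ S ∣))
∣⁅x⁆∪S∣≤1+∣S∣ zero    (outside ∷ S) = s≤s (≤-reflexive (cong ∣_∣ (∪-identityˡ S)))
∣⁅x⁆∪S∣≤1+∣S∣ (suc x) (inside  ∷ S) = s≤s (∣⁅x⁆∪S∣≤1+∣S∣ x S)
∣⁅x⁆∪S∣≤1+∣S∣ (suc x) (outside ∷ S) = ∣⁅x⁆∪S∣≤1+∣S∣ x S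

fromList : ∀ {n} → List (Fin n) → Subset n
fromList []       = Subset.⊥
fromList (x ∷ xs) = ⁅ x ⁆ ∪ fromList xs

∣fromList∣≤length : ∀ {n} (xs : List (Fin n)) → ∣ fromList xs ∣ ≤ length xs
∣fromList∣≤length {n} []       = ≤-reflexive (∣⊥∣≡0 n)
∣fromList∣≤length     (x ∷ xs) = ≤-trans (∣⁅x⁆∪S∣≤1+∣S∣ x (fromList xs)) (s≤s (∣fromList∣≤length xs))

∈-fromList⁺ : ∀ {n} {x : Fin n} {xs : List (Fin n)} → x ∈ xs → x Subset.∈ fromList xs
∈-fromList⁺ {x = x} (here refl) = x∈p∪q⁺ (inj₁ (x∈⁅x⁆ x))
∈-fromList⁺         (there x∈)  = x∈p∪q⁺ (inj₂ (∈-fromList⁺ x∈))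

∈-fromList⁻ : ∀ {n} {x : Fin n} (xs : List (Fin n)) → x Subset.∈ fromList xs → x ∈ xs
∈-fromList⁻ []       x∈ = contradiction x∈ ∉⊥
∈-fromList⁻ (y ∷ xs) x∈ with x∈p∪q⁻ ⁅ y ⁆ (fromList xs) x∈
... | inj₁ x∈⁅y⁆ = here (x∈⁅y⁆⇒x≡y y x∈⁅y⁆)
... | inj₂ x∈xs  = there (∈-fromList⁻ xs x∈xs)

length-take-≤ : ∀ {A : Set} j (xs : List A) → length (take j xs) ≤ j
length-take-≤ j xs = ≤-trans (≤-reflexive (length-take j xs)) (m⊓n≤m j (length xs))

∈-take⇒∈ : ∀ {A : Set} j {xs : List A} {x} → x ∈ take j xs → x ∈ xs
∈-take⇒∈ j {xs} x∈ = subst (_ ∈_) (take++drop≡id j xs) (∈-++⁺ˡ x∈)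

∈-drop⇒∈ : ∀ {A : Set} j {xs : List A} {x} → x ∈ drop j xs → x ∈ xs
∈-drop⇒∈ j {xs} x∈ = subst (_ ∈_) (take++drop≡id j xs) (∈-++⁺ʳ (take j xs) x∈)

∈⇒∈-take⊎∈-drop : ∀ {A : Set} j {xs : List A} {x} → x ∈ xs → x ∈ take j xs ⊎ x ∈ drop j xs
∈⇒∈-take⊎∈-drop j {xs} x∈ = ∈-++⁻ (take j xs) (subst (_ ∈_) (sym (take++drop≡id j xs)) x∈)

Unique⇒take∩drop≡∅ : ∀ {A : Set} j {xs : List A} → Unique xs → ∀ {x} → x ∈ take j xs → x ∉ drop j xs
Unique⇒take∩drop≡∅ (suc j) {_ ∷ xs} (y∉ ∷ _)  (here refl) x∈drop = All.lookup y∉ (∈-drop⇒∈ j x∈drop) refl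
Unique⇒take∩drop≡∅ (suc j) {_ ∷ xs} (_ ∷ uniq) (there x∈) x∈drop = Unique⇒take∩drop≡∅ j uniq x∈ x∈drop

-- A strategy as a decision tree, whose branches carry the last answer, the unselected doors and the
-- remaining thresholds. A `Searcher` sees only the list of answers, so `follow` replays them from
-- the root, the oldest answer being at the end of the list.
data Plan (n m : ℕ) : Set where
  stop : Plan n m
  ask  : Guess n m → (Fin n → Plan n m) → Plan n m

guessOf : ∀ {n m} → Plan n m → Guess n m
-- In the plans used below, `stop` is reached only after the last guess, so the empty guess is a
-- placeholder.
guessOf {n} stop  = Subset.⊥ , ≤-trans (≤-reflexive (∣⊥∣≡0 n)) z≤n
guessOf (ask S _) = S

continue : ∀ {n m} → Plan n m → Fin n → Plan n m
continue stop        y = stop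
continue (ask _ next) y = next y

follow : ∀ {n m} → Plan n m → List (Fin n) → Plan n m
follow P []       = P
follow P (y ∷ ys) = continue (follow P ys) y

searcher : ∀ {n m} → Plan n m → Searcher n m
searcher P ys = guessOf (follow P ys)

guess : ∀ {n m} (xs : List (Fin n)) → length xs ≤ m → Guess n m
guess xs len≤ = fromList xs , ≤-trans (∣fromList∣≤length xs) len≤

module _ {n : ℕ} (k-1 : ℕ) where
  private k = suc k-1

  -- The last answer was y, l distinct doors were answered, xs were never selected.
  resume : (r l : ℕ) (y : Fin n) → List (Fin n) → Vec ℕ r → Plan n k
  resume zero    l y xs []       = stop
  resume (suc r) l y xs (t ∷ ts) =
    if does (t <? k * (l + suc r))
    then ask (guess (y ∷ take k-1 xs) (s≤s (length-take-≤ k-1 xs)))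
             (λ y′ → resume r (if does (y′ ≟ᶠ y) then l else suc l) y′ (drop k-1 xs) ts)
    else ask (guess (take k xs) (length-take-≤ k xs))
             (λ y′ → resume r (suc l) y′ (drop k xs) ts)

  seedPlan : (d-1 : ℕ) → List (Fin n) → Vec ℕ d-1 → Plan n k
  seedPlan d-1 xs ts = ask (guess (take k xs) (length-take-≤ k xs)) (λ y → resume d-1 1 y (drop k xs) ts)

-- Runs with forced answers are wins

module _ {A : Set} (p : A → ℕ) where
  open Count p

  -- Where the indicator vanishes the bound is trivial; elsewhere what it tests becomes available as
  -- a hypothesis. This, with `oneFull-≤`, is how a counted run is turned into facts about the game.
  allEmpty-≤ : ∀ j κ xs {b} → ((∀ {v} → v ∈ take j xs → p v ≡ 0) → κ (drop j xs) ≤ b) → allEmpty j κ xs ≤ b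
  allEmpty-≤ zero    κ xs       H = H λ ()
  allEmpty-≤ (suc j) κ []       H = z≤n
  allEmpty-≤ (suc j) κ (u ∷ xs) H with p u in eq
  ... | zero  = allEmpty-≤ j κ xs (λ empty → H λ { (here refl) → eq ; (there v∈) → empty v∈ })
  ... | suc _ = z≤n

  oneFull-≤ : ∀ j κ xs {b} →
    (∀ u → u ∈ take j xs → p u ≢ 0 → (∀ {v} → v ∈ take j xs → v ≡ u ⊎ p v ≡ 0) → κ u (drop j xs) ≤ b) →
    oneFull j κ xs ≤ b
  oneFull-≤ zero    κ xs       H = z≤n
  oneFull-≤ (suc j) κ []       H = z≤n
  oneFull-≤ (suc j) κ (u ∷ xs) H with p u in eq
  ... | zero  = oneFull-≤ j κ xs (λ v v∈ full empty →
                  H v (there v∈) full λ { (here refl) → inj₂ eq ; (there w∈) → empty w∈ })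
  ... | suc _ = allEmpty-≤ j (κ u) xs (λ empty →
                  H u (here refl) (λ eq′ → contradiction (trans (sym eq) eq′) λ ())
                    λ { (here refl) → inj₁ refl ; (there v∈) → inj₂ (empty v∈) })

  support≡0⇒≡0 : ∀ xs → support xs ≡ 0 → ∀ {u} → u ∈ xs → p u ≡ 0
  support≡0⇒≡0 (u ∷ xs) eq u∈ with p u in pu | u∈
  ... | zero | here refl = pu
  ... | zero | there v∈  = support≡0⇒≡0 xs eq v∈

found-here : ∀ {n m} (S : Guess n m) (x : Fin n) (h : History n m) → found ((S , x) ∷ h) x ≡ suc (found h x)
found-here S x h = cong length (filter-accept (x ≟ᶠ_) refl)

found-there : ∀ {n m} (S : Guess n m) {x u : Fin n} (h : History n m) → x ≢ u → found ((S , u) ∷ h) x ≡ found h x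
found-there S {x} h x≢u = cong length (filter-reject (x ≟ᶠ_) x≢u)

module Winning {n d k-1 : ℕ} (τ : Hider n d (suc k-1)) where
  open Hider τ
  open import Data.List.Membership.DecPropositional {A = Fin n} _≟ᶠ_ using () renaming (_∈?_ to _∈ˡ?_)
  private
    k = suc k-1
    p : Fin n → ℕ
    p = lookup (proj₁ placement)
  open Count p

  -- Carries the current subtree along, so that induction on the remaining guesses need not replay
  -- the earlier answers.
  playPlan : ℕ → Plan n k → History n k → Bool
  playPlan zero    P h = does (allFound? placement h)
  playPlan (suc r) P h = let S = guessOf P in
    if does (any? (hit? placement h S)) then playPlan r (continue P (reveal h S)) ((S , reveal h S) ∷ h) else false

  play≡playPlan : ∀ P r h → play (searcher P) τ r h ≡ playPlan r (follow P (answers h)) h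
  play≡playPlan P zero    h = refl
  play≡playPlan P (suc r) h with does (any? (hit? placement h (searcher P (answers h))))
  ... | true  = play≡playPlan P r _
  ... | false = refl

  -- When only one door can be hit, `legal` leaves the hider no choice, so the next state is the
  -- same for every `reveal`.
  playPlan-forced : ∀ r S next h u → Hit placement h S u → (∀ x → Hit placement h S x → x ≡ u) →
    playPlan (suc r) (ask S next) h ≡ playPlan r (next u) ((S , u) ∷ h)
  playPlan-forced r S next h u hit only
    rewrite dec-true (any? (hit? placement h S)) (u , hit) | only _ (legal h S (u , hit)) = refl

  record Fresh (h : History n k) (xs : List (Fin n)) : Set where
    field
      unique  : Unique xs
      unfound : ∀ {x} → x ∈ xs → found h x ≡ 0

  Settled : History n k → List (Fin n) → Set
  Settled h xs = ∀ {x} → x ∉ xs → found h x ≡ p x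

  -- The invariant under which the state `c`, `xs` of `good` describes the actual game: a later hit
  -- can occur only at the last answer `y` or at an unselected door.
  record Pending (h : History n k) (y : Fin n) (c : ℕ) (xs : List (Fin n)) : Set where
    field
      fresh   : Fresh h xs
      y∉xs    : y ∉ xs
      left    : found h y + c ≡ p y
      settled : ∀ {x} → x ≢ y → x ∉ xs → found h x ≡ p x

  pending-0 : ∀ {h y xs} → Pending h y 0 xs → Settled h xs
  pending-0 {y = y} P {x} x∉ with x ≟ᶠ y
  ... | yes refl = trans (sym (+-identityʳ _)) (Pending.left P)
  ... | no  x≢y  = Pending.settled P x≢y x∉

  fresh-drop : ∀ {h xs} S u j → Fresh h xs → u ∉ drop j xs → Fresh ((S , u) ∷ h) (drop j xs)
  fresh-drop {h} S u j F u∉ = record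
    { unique  = drop⁺ j (Fresh.unique F)
    ; unfound = λ x∈ → trans (found-there S h (λ { refl → u∉ x∈ })) (Fresh.unfound F (∈-drop⇒∈ j x∈))
    }

  -- Treats together the guesses that open a new door: the first guess, `k` fresh doors, and `k-1`
  -- fresh doors with the exhausted last answer. `S⁻` admits that extra door because doors outside
  -- `xs` are settled and cannot be hit.
  module NewDoor {h xs} (F : Fresh h xs) (St : Settled h xs) (S : Guess n k) (j : ℕ)
    (S⁺ : ∀ {x} → x ∈ take j xs → x Subset.∈ proj₁ S)
    (S⁻ : ∀ {x} → x Subset.∈ proj₁ S → x ∈ take j xs ⊎ x ∉ xs)
    {u} (u∈ : u ∈ take j xs) (full : p u ≢ 0) (empty : ∀ {v} → v ∈ take j xs → v ≡ u ⊎ p v ≡ 0) where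

    open Fresh F

    hit : Hit placement h S u
    hit = S⁺ u∈ , subst (_< p u) (sym (unfound (∈-take⇒∈ j u∈))) (n≢0⇒n>0 full)

    only : ∀ x → Hit placement h S x → x ≡ u
    only x (x∈S , more) with S⁻ x∈S
    ... | inj₂ x∉ = contradiction more (<-irrefl (St x∉))
    ... | inj₁ x∈ with empty x∈
    ...   | inj₁ x≡u  = x≡u
    ...   | inj₂ px≡0 = contradiction (subst (found h x <_) px≡0 more) n≮0

    u∉drop : u ∉ drop j xs
    u∉drop = Unique⇒take∩drop≡∅ j unique u∈

    pending : Pending ((S , u) ∷ h) u (pred (p u)) (drop j xs)
    pending = record
      { fresh   = fresh-drop S u j F u∉drop
      ; y∉xs    = u∉drop
      ; left    = trans (cong (_+ pred (p u)) (trans (found-here S u h) (cong suc (unfound (∈-take⇒∈ j u∈)))))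
                        (suc-pred (p u) {{≢-nonZero full}})
      ; settled = λ {x} x≢u x∉ → trans (found-there S h x≢u) (rest x≢u x∉)
      }
      where
      rest : ∀ {x} → x ≢ u → x ∉ drop j xs → found h x ≡ p x
      rest {x} x≢u x∉ with x ∈ˡ? xs
      ... | no  x∉xs = St x∉xs
      ... | yes x∈xs with ∈⇒∈-take⊎∈-drop j x∈xs
      ...   | inj₂ x∈drop = contradiction x∈drop x∉
      ...   | inj₁ x∈take with empty x∈take
      ...     | inj₁ x≡u  = contradiction x≡u x≢u
      ...     | inj₂ px≡0 = trans (unfound x∈xs) (sym px≡0)

  -- Induction along the run. The factor of `good` tested at each guess says that exactly one
  -- selected door can be hit; the answer is then forced, and `Pending` passes to the next state.
  good≤wins : ∀ r l y c xs ts h → Pending h y c xs →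
    good n k-1 r l c xs ts ≤ indicator (playPlan r (resume k-1 r l y xs ts) h)
  good≤wins zero l y (suc c) xs [] h P = z≤n
  good≤wins zero l y zero    xs [] h P with support xs in s≡
  ... | suc _ = z≤n
  ... | zero = ≤-reflexive (cong indicator (sym (dec-true (allFound? placement h) all-found)))
    where
    all-found : AllFound placement h
    all-found x with x ∈ˡ? xs
    ... | no  x∉ = pending-0 P x∉
    ... | yes x∈ = trans (Fresh.unfound (Pending.fresh P) x∈) (sym (support≡0⇒≡0 p xs s≡ x∈))
  good≤wins (suc r) l y zero xs (t ∷ ts) h P with does (t <? k * (l + suc r))
  ... | true = oneFull-≤ p k-1 _ xs case
    where
    open Pending P
    S = guess (y ∷ take k-1 xs) (s≤s (length-take-≤ k-1 xs))
    next = λ y′ → resume k-1 r (if does (y′ ≟ᶠ y) then l else suc l) y′ (drop k-1 xs) ts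
    S⁻ : ∀ {x} → x Subset.∈ proj₁ S → x ∈ take k-1 xs ⊎ x ∉ xs
    S⁻ x∈ with ∈-fromList⁻ (y ∷ take k-1 xs) x∈
    ... | here refl = inj₂ y∉xs
    ... | there x∈′ = inj₁ x∈′
    case : ∀ u → u ∈ take k-1 xs → p u ≢ 0 → (∀ {v} → v ∈ take k-1 xs → v ≡ u ⊎ p v ≡ 0) →
      good n k-1 r (suc l) (pred (p u)) (drop k-1 xs) ts ≤ indicator (playPlan (suc r) (ask S next) h)
    case u u∈ full empty = ≤-trans (good≤wins r (suc l) u _ _ ts _ pending)
      (≤-reflexive (cong indicator (sym (trans (playPlan-forced r S next h u hit only)
        (cong (λ b → playPlan r (resume k-1 r (if b then l else suc l) u (drop k-1 xs) ts) ((S , u) ∷ h))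
          -- A fresh door differs from `y`, so the plan raises the number of distinct answered doors
          -- just as `good` does.
          (dec-false (u ≟ᶠ y) (λ { refl → y∉xs (∈-take⇒∈ k-1 u∈) })))))))
      where open NewDoor fresh (pending-0 P) S k-1 (∈-fromList⁺ ∘ there) S⁻ u∈ full empty
  ... | false = oneFull-≤ p k _ xs case
    where
    open Pending P
    S = guess (take k xs) (length-take-≤ k xs)
    next = λ y′ → resume k-1 r (suc l) y′ (drop k xs) ts
    case : ∀ u → u ∈ take k xs → p u ≢ 0 → (∀ {v} → v ∈ take k xs → v ≡ u ⊎ p v ≡ 0) →
      good n k-1 r (suc l) (pred (p u)) (drop k xs) ts ≤ indicator (playPlan (suc r) (ask S next) h)
    case u u∈ full empty = ≤-trans (good≤wins r (suc l) u _ _ ts _ pending)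
      (≤-reflexive (cong indicator (sym (playPlan-forced r S next h u hit only))))
      where open NewDoor fresh (pending-0 P) S k ∈-fromList⁺ (inj₁ ∘ ∈-fromList⁻ _) u∈ full empty
  good≤wins (suc r) l y (suc c) xs (t ∷ ts) h P with does (t <? k * (l + suc r))
  ... | false = z≤n
  ... | true = allEmpty-≤ p k-1 _ xs case
    where
    open Pending P
    open Fresh fresh
    S = guess (y ∷ take k-1 xs) (s≤s (length-take-≤ k-1 xs))
    next = λ y′ → resume k-1 r (if does (y′ ≟ᶠ y) then l else suc l) y′ (drop k-1 xs) ts
    hit : Hit placement h S y
    hit = ∈-fromList⁺ {xs = y ∷ take k-1 xs} (here refl) , subst (found h y <_) left (m<m+n (found h y) z<s)
    case : (∀ {v} → v ∈ take k-1 xs → p v ≡ 0) →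
      good n k-1 r l c (drop k-1 xs) ts ≤ indicator (playPlan (suc r) (ask S next) h)
    case empty = ≤-trans (good≤wins r l y c _ ts _ pending)
      (≤-reflexive (cong indicator (sym (trans (playPlan-forced r S next h y hit only)
        (cong (λ b → playPlan r (resume k-1 r (if b then l else suc l) y (drop k-1 xs) ts) ((S , y) ∷ h))
          (dec-true (y ≟ᶠ y) refl))))))
      where
      only : ∀ x → Hit placement h S x → x ≡ y
      only x (x∈S , more) with ∈-fromList⁻ (y ∷ take k-1 xs) x∈S
      ... | here x≡y = x≡y
      ... | there x∈ = contradiction (subst (found h x <_) (empty x∈) more) n≮0
      y∉drop : y ∉ drop k-1 xs
      y∉drop = y∉xs ∘ ∈-drop⇒∈ k-1
      pending : Pending ((S , y) ∷ h) y c (drop k-1 xs)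
      pending = record
        { fresh   = fresh-drop S y k-1 fresh y∉drop
        ; y∉xs    = y∉drop
        ; left    = trans (cong (_+ c) (found-here S y h)) (trans (sym (+-suc _ c)) left)
        ; settled = λ {x} x≢y x∉ → trans (found-there S h x≢y) (rest x≢y x∉)
        }
        where
        rest : ∀ {x} → x ≢ y → x ∉ drop k-1 xs → found h x ≡ p x
        rest {x} x≢y x∉ with x ∈ˡ? xs
        ... | no  x∉xs = settled x≢y x∉xs
        ... | yes x∈xs with ∈⇒∈-take⊎∈-drop k-1 x∈xs
        ...   | inj₂ x∈drop = contradiction x∈drop x∉
        ...   | inj₁ x∈take = trans (unfound x∈xs) (sym (empty x∈take))

  goodSeed≤wins : ∀ d-1 xs ts → Unique xs → (∀ x → x ∈ xs) →
    goodSeed n k-1 d-1 xs ts ≤ indicator (play (searcher (seedPlan k-1 d-1 xs ts)) τ (suc d-1) [])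
  goodSeed≤wins d-1 xs ts uniq full rewrite play≡playPlan (seedPlan k-1 d-1 xs ts) (suc d-1) [] = oneFull-≤ p k _ xs case
    where
    S = guess (take k xs) (length-take-≤ k xs)
    next = λ y → resume k-1 d-1 1 y (drop k xs) ts
    case : ∀ u → u ∈ take k xs → p u ≢ 0 → (∀ {v} → v ∈ take k xs → v ≡ u ⊎ p v ≡ 0) →
      good n k-1 d-1 1 (pred (p u)) (drop k xs) ts ≤ indicator (playPlan (suc d-1) (ask S next) [])
    case u u∈ pu empty = ≤-trans (good≤wins d-1 1 u _ _ ts _ pending)
      (≤-reflexive (cong indicator (sym (playPlan-forced d-1 S next [] u hit only))))
      where
      fresh : Fresh [] xs
      fresh = record { unique = uniq ; unfound = λ _ → refl }
      settled : Settled [] xs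
      -- Before the first guess every door is in `xs`, so there is nothing to settle.
      settled x∉ = contradiction (full _) x∉
      open NewDoor fresh settled S k ∈-fromList⁺ (inj₁ ∘ ∈-fromList⁻ _) u∈ pu empty

-- The hider's strategy

elements : ∀ {n} → Subset n → List (Fin n)
elements []            = []
elements (inside  ∷ S) = zero ∷ map suc (elements S)
elements (outside ∷ S) = map suc (elements S)

length-elements : ∀ {n} (S : Subset n) → length (elements S) ≡ ∣ S ∣
length-elements []            = refl
length-elements (inside  ∷ S) = cong suc (trans (length-map suc (elements S)) (length-elements S))
length-elements (outside ∷ S) = trans (length-map suc (elements S)) (length-elements S)

∈-elements : ∀ {n} {x : Fin n} {S} → x Subset.∈ S → x ∈ elements S
∈-elements                     here       = here refl
∈-elements {S = inside  ∷ S} (there x∈S) = there (∈-map⁺ suc (∈-elements x∈S))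
∈-elements {S = outside ∷ S} (there x∈S) = ∈-map⁺ suc (∈-elements x∈S)

emptyDoor : ∀ {n d} → Placement n d → Placement (suc n) d
emptyDoor (p , eq) = 0 ∷ p , eq

addTreasure : ∀ {n d} → Placement (suc n) d → Placement (suc n) (suc d)
addTreasure (x ∷ p , eq) = suc x ∷ p , cong suc eq

-- Either the first door is empty, or removing one of its treasures gives a placement of one
-- treasure fewer. The two cases are disjoint, and their sizes add up by Pascal's rule.
placements : ∀ n d → List (Placement n d)
placements zero    zero    = ([] , refl) ∷ []
placements zero    (suc d) = []
placements (suc n) zero    = map emptyDoor (placements n zero)
placements (suc n) (suc d) = map emptyDoor (placements n (suc d)) ++ map addTreasure (placements (suc n) d)

length-placements : ∀ n d → length (placements (suc n) d) ≡ (n + d) C d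
length-placements zero    zero    = refl
length-placements (suc n) zero    = trans (length-map emptyDoor (placements (suc n) 0)) (length-placements n zero)
length-placements zero    (suc d) = begin
  length (map addTreasure (placements 1 d)) ≡⟨ length-map addTreasure (placements 1 d) ⟩
  length (placements 1 d)                   ≡⟨ length-placements 0 d ⟩
  d C d                                     ≡⟨ nCn≡1 d ⟩
  1                                         ≡⟨ nCn≡1 (suc d) ⟨
  suc d C suc d                             ∎
  where open ≡-Reasoning
length-placements (suc n) (suc d) = begin
  length (map emptyDoor (placements (suc n) (suc d)) ++ map addTreasure (placements (suc (suc n)) d))
    ≡⟨ length-++ (map emptyDoor (placements (suc n) (suc d))) ⟩
  length (map emptyDoor (placements (suc n) (suc d))) + length (map addTreasure (placements (suc (suc n)) d))
    ≡⟨ cong₂ _+_ (length-map emptyDoor (placements (suc n) (suc d))) (length-map addTreasure (placements (suc (suc n)) d)) ⟩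
  length (placements (suc n) (suc d)) + length (placements (suc (suc n)) d)
    ≡⟨ cong₂ _+_ (length-placements n (suc d)) (length-placements (suc n) d) ⟩
  (n + suc d) C suc d + (suc n + d) C d
    ≡⟨ cong (λ m → m C suc d + (suc n + d) C d) (+-suc n d) ⟩
  (suc n + d) C suc d + (suc n + d) C d
    ≡⟨ +-comm ((suc n + d) C suc d) _ ⟩
  (suc n + d) C d + (suc n + d) C suc d
    ≡⟨ nCk+nC[k+1]≡[n+1]C[k+1] (suc n + d) d ⟩
  suc (suc n + d) C suc d
    ≡⟨ cong (λ m → suc m C suc d) (+-suc n d) ⟨
  suc (n + suc d) C suc d ∎
  where open ≡-Reasoning

Distinct : ∀ {n d} → List (Placement n d) → Set
Distinct = AllPairs (λ p q → proj₁ p ≢ proj₁ q)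

placements-distinct : ∀ n d → Distinct (placements n d)
placements-distinct zero    zero    = [] ∷ []
placements-distinct zero    (suc d) = []
placements-distinct (suc n) zero    =
  AllPairs.map⁺ (AllPairs.map (λ p≢q eq → p≢q (cong Vec.tail eq)) (placements-distinct n zero))
placements-distinct (suc n) (suc d) = AllPairs.++⁺
  (AllPairs.map⁺ (AllPairs.map (λ p≢q eq → p≢q (cong Vec.tail eq)) (placements-distinct n (suc d))))
  (AllPairs.map⁺ (AllPairs.map injective (placements-distinct (suc n) d)))
  (All.map⁺ (All.universal (λ _ → All.map⁺ (All.universal disjoint _)) _))
  where
  injective : {p q : Placement (suc n) d} → proj₁ p ≢ proj₁ q → proj₁ (addTreasure p) ≢ proj₁ (addTreasure q)
  injective {x ∷ p , _} {y ∷ q , _} p≢q refl = p≢q refl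
  disjoint : ∀ {p : Vec ℕ n} (q : Placement (suc n) d) → 0 ∷ p ≢ proj₁ (addTreasure q)
  disjoint (y ∷ q , _) ()

-- Reveals any hit; the default door only matters when the guess misses.
obliging : ∀ {n d k} → Fin n → Placement n d → Hider n d k
obliging {n} default p = record
  { placement = p
  ; reveal    = λ h S → pick (any? (hit? p h S))
  ; legal     = λ h S hit → pick-legal (any? (hit? p h S)) hit
  }
  where
  pick : ∀ {P : Fin n → Set} → Dec (∃ P) → Fin n
  pick (yes (x , _)) = x
  pick (no _)        = default
  pick-legal : ∀ {P : Fin n → Set} (P? : Dec (∃ P)) → ∃ P → P (pick P?)
  pick-legal (yes (_ , Px)) _  = Px
  pick-legal (no ¬P)        P! = contradiction P! ¬P

∑-indicator≤1 : ∀ {A : Set} {P : A → Set} (P? : ∀ x → Dec (P x)) (xs : List A) →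
  AllPairs (λ x y → P x → ¬ P y) xs → ∑ xs (λ x → indicator (does (P? x))) ≤ 1
∑-indicator≤1 P? []       _              = z≤n
∑-indicator≤1 P? (x ∷ xs) (x-excl ∷ excl) with P? x
... | no  _  = ∑-indicator≤1 P? xs excl
... | yes Px = s≤s (≤-reflexive (trans
  (∑-cong xs (λ {y} y∈ → cong indicator (dec-false (P? y) (All.lookup x-excl y∈ Px)))) (∑-zero xs)))

lookup-injective : ∀ {A : Set} {n} {xs ys : Vec A n} → (∀ i → lookup xs i ≡ lookup ys i) → xs ≡ ys
lookup-injective {xs = xs} {ys} eq =
  trans (sym (tabulate∘lookup xs)) (trans (tabulate-cong eq) (tabulate∘lookup ys))

module _ {n d k : ℕ} (default : Fin n) (σ : Searcher n k) where

  -- The sum runs over placements while the history stays fixed. Each guess multiplies the bound by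
  -- its at most `k` possible answers, and a finished history records the contents of every door, so
  -- it fits at most one placement.
  wins≤k^r : (ps : List (Placement n d)) → Distinct ps → ∀ r h →
    ∑ ps (λ p → indicator (play σ (obliging default p) r h)) ≤ k ^ r
  wins≤k^r ps ps≢ zero    h = ∑-indicator≤1 (λ p → allFound? p h) ps
    (AllPairs.map (λ p≢q all all′ → p≢q (lookup-injective (λ x → trans (sym (all x)) (all′ x)))) ps≢)
  wins≤k^r ps ps≢ (suc r) h = begin
    ∑ ps (λ p → indicator (play σ (obliging default p) (suc r) h))
      -- The revealed door depends on the placement. Replacing it by the sum over all selected doors
      -- removes this dependence, so that the history can be extended uniformly in `p`.
      ≤⟨ ∑-mono ps (λ {p} _ → answered p) ⟩
    ∑ ps (λ p → ∑ (elements (proj₁ S)) (λ y → indicator (play σ (obliging default p) r ((S , y) ∷ h))))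
      ≡⟨ ∑-swap ps (elements (proj₁ S)) _ ⟩
    ∑ (elements (proj₁ S)) (λ y → ∑ ps (λ p → indicator (play σ (obliging default p) r ((S , y) ∷ h))))
      ≤⟨ ∑-mono (elements (proj₁ S)) (λ {y} _ → wins≤k^r ps ps≢ r ((S , y) ∷ h)) ⟩
    ∑ (elements (proj₁ S)) (λ _ → k ^ r)
      ≡⟨ ∑-const (elements (proj₁ S)) (k ^ r) ⟩
    length (elements (proj₁ S)) * k ^ r
      ≤⟨ *-monoˡ-≤ (k ^ r) (≤-trans (≤-reflexive (length-elements (proj₁ S))) (proj₂ S)) ⟩
    k ^ suc r ∎
    where
    open ≤-Reasoning
    S = σ (answers h)
    answered : ∀ p → indicator (play σ (obliging default p) (suc r) h) ≤
      ∑ (elements (proj₁ S)) (λ y → indicator (play σ (obliging default p) r ((S , y) ∷ h)))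
    answered p with any? (hit? p h S)
    ... | no  _                = z≤n
    ... | yes (x , x∈S , more) =
      ∑-term-≤ (λ y → indicator (play σ (obliging default p) r ((S , y) ∷ h))) (∈-elements x∈S)

-- Expectations

open import Data.Integer.Base as ℤ using (+_)
import Data.Integer.Properties as ℤ
open import Data.Rational.Base as ℚ using (ℚ; 0ℚ; 1ℚ; _/_)
import Data.Rational.Properties as ℚ
open import Data.Rational.Unnormalised.Base as ℚᵘ using (mkℚᵘ; *≤*; *≡*)
import Data.Rational.Unnormalised.Properties as ℚᵘ

-- `_/_` reduces fractions to lowest terms, so the identity is checked on unnormalised fractions,
-- where it is a cross-multiplication.
/-+ : ∀ a b T .{{_ : NonZero T}} → + a / T ℚ.+ + b / T ≡ + (a + b) / T
/-+ a b T@(suc t) = ℚ.toℚᵘ-injective (begin-equality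
  ℚ.toℚᵘ (+ a / T ℚ.+ + b / T)            ≃⟨ ℚ.toℚᵘ-homo-+ (+ a / T) (+ b / T) ⟩
  ℚ.toℚᵘ (+ a / T) ℚᵘ.+ ℚ.toℚᵘ (+ b / T)  ≃⟨ ℚᵘ.+-cong (ℚ.toℚᵘ-fromℚᵘ (mkℚᵘ (+ a) t)) (ℚ.toℚᵘ-fromℚᵘ (mkℚᵘ (+ b) t)) ⟩
  mkℚᵘ (+ a) t ℚᵘ.+ mkℚᵘ (+ b) t          ≃⟨ *≡* (trans (cong (ℤ._* + T) numerator)
                                           (trans (ℤ.*-assoc (+ (a + b)) (+ T) (+ T))
                                             (cong (+ (a + b) ℤ.*_) (sym (ℤ.pos-* T T))))) ⟩
  mkℚᵘ (+ (a + b)) t                      ≃⟨ ℚ.toℚᵘ-fromℚᵘ (mkℚᵘ (+ (a + b)) t) ⟨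
  ℚ.toℚᵘ (+ (a + b) / T)                  ∎)
  where
  open ℚᵘ.≤-Reasoning
  numerator : + a ℤ.* + T ℤ.+ + b ℤ.* + T ≡ + (a + b) ℤ.* + T
  numerator = sym (trans (cong (ℤ._* + T) (ℤ.pos-+ a b)) (ℤ.*-distribʳ-+ (+ T) (+ a) (+ b)))

/-mono-≤ : ∀ a b T T′ .{{_ : NonZero T}} .{{_ : NonZero T′}} → a * T′ ≤ b * T → + a / T ℚ.≤ + b / T′
/-mono-≤ a b T@(suc t) T′@(suc t′) le = ℚ.toℚᵘ-cancel-≤ (begin
  ℚ.toℚᵘ (+ a / T)   ≃⟨ ℚ.toℚᵘ-fromℚᵘ (mkℚᵘ (+ a) t) ⟩
  mkℚᵘ (+ a) t       ≤⟨ *≤* (subst₂ ℤ._≤_ (ℤ.pos-* a T′) (ℤ.pos-* b T) (ℤ.+≤+ le)) ⟩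
  mkℚᵘ (+ b) t′      ≃⟨ ℚ.toℚᵘ-fromℚᵘ (mkℚᵘ (+ b) t′) ⟨
  ℚ.toℚᵘ (+ b / T′)  ∎)
  where open ℚᵘ.≤-Reasoning

n/n≡1 : ∀ T .{{_ : NonZero T}} → + T / T ≡ 1ℚ
n/n≡1 T = ℚ.≤-antisym (/-mono-≤ T 1 T 1 (≤-reflexive (*-comm T 1))) (/-mono-≤ 1 T 1 T (≤-reflexive (*-comm 1 T)))

sum-weights : ∀ T .{{_ : NonZero T}} (xs : List A) →
  sumℚ (map proj₂ (map (λ x → x , + 1 / T) xs)) ≡ + length xs / T
sum-weights T []       = sym (ℚ.0/n≡0 T)
sum-weights T (x ∷ xs) = trans (cong (ℚ._+_ (+ 1 / T)) (sum-weights T xs)) (/-+ 1 (length xs) T)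

uniform : (xs : List A) .{{_ : NonZero (length xs)}} → Mixed A
uniform xs = record
  { atoms  = map (λ x → x , + 1 / length xs) xs
  ; nonNeg = All.map⁺ (All.universal (λ _ → ℚ.nonNegative⁻¹ _ {{ℚ.normalize-nonNeg 1 (length xs)}}) xs)
  ; total  = trans (sum-weights (length xs) xs) (n/n≡1 (length xs))
  }

𝔼-uniform : (xs : List A) .{{_ : NonZero (length xs)}} (b : A → Bool) →
  𝔼 (uniform xs) (λ x → if b x then 1ℚ else 0ℚ) ≡ + ∑ xs (indicator ∘ b) / length xs
𝔼-uniform xs b = go (length xs) xs
  where
  -- The denominator stays fixed while the list shrinks.
  go : ∀ T .{{_ : NonZero T}} ys →
    sumℚ (map (λ a → proj₂ a ℚ.* (if b (proj₁ a) then 1ℚ else 0ℚ)) (map (λ x → x , + 1 / T) ys)) ≡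
    + ∑ ys (indicator ∘ b) / T
  go T []       = sym (ℚ.0/n≡0 T)
  go T (y ∷ ys) with b y
  ... | true  = trans (cong₂ ℚ._+_ (ℚ.*-identityʳ (+ 1 / T)) (go T ys)) (/-+ 1 (∑ ys (indicator ∘ b)) T)
  ... | false = trans (cong₂ ℚ._+_ (ℚ.*-zeroʳ (+ 1 / T)) (go T ys)) (ℚ.+-identityˡ _)

module _ (xs : List A) .{{_ : NonZero (length xs)}} (b : A → Bool) (m c : ℕ) .{{_ : NonZero c}} where

  𝔼-uniform-≥ : m * length xs ≤ ∑ xs (indicator ∘ b) * c →
    + m / c ℚ.≤ 𝔼 (uniform xs) (λ x → if b x then 1ℚ else 0ℚ)
  𝔼-uniform-≥ m≤ = ℚ.≤-trans (/-mono-≤ m (∑ xs (indicator ∘ b)) c (length xs) m≤) (ℚ.≤-reflexive (sym (𝔼-uniform xs b)))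

  𝔼-uniform-≤ : ∑ xs (indicator ∘ b) * c ≤ m * length xs →
    𝔼 (uniform xs) (λ x → if b x then 1ℚ else 0ℚ) ℚ.≤ + m / c
  𝔼-uniform-≤ ≤m = ℚ.≤-trans (ℚ.≤-reflexive (𝔼-uniform xs b)) (/-mono-≤ (∑ xs (indicator ∘ b)) m (length xs) c ≤m)

module _ (μ : Mixed A) where
  open Mixed μ

  private
    expect : List (A × ℚ) → (A → ℚ) → ℚ
    expect as f = sumℚ (map (λ a → proj₂ a ℚ.* f (proj₁ a)) as)

    expect-const : ∀ as v → expect as (λ _ → v) ≡ sumℚ (map proj₂ as) ℚ.* v
    expect-const []       v = sym (ℚ.*-zeroˡ v)
    expect-const (a ∷ as) v = trans (cong (ℚ._+_ (proj₂ a ℚ.* v)) (expect-const as v)) (sym (ℚ.*-distribʳ-+ v (proj₂ a) _))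

    expect-mono : ∀ {as} → All (λ a → 0ℚ ℚ.≤ proj₂ a) as → ∀ {f g} → (∀ a → f a ℚ.≤ g a) → expect as f ℚ.≤ expect as g
    expect-mono []             f≤g = ℚ.≤-refl
    expect-mono {a ∷ _} (w≥0 ∷ ws) f≤g =
      ℚ.+-mono-≤ (ℚ.*-monoˡ-≤-nonNeg (proj₂ a) {{ℚ.nonNegative w≥0}} (f≤g (proj₁ a))) (expect-mono ws f≤g)

  𝔼-const : ∀ v → 𝔼 μ (λ _ → v) ≡ v
  𝔼-const v = trans (expect-const atoms v) (trans (cong (ℚ._* v) total) (ℚ.*-identityˡ v))

  𝔼-mono : ∀ {f g} → (∀ a → f a ℚ.≤ g a) → 𝔼 μ f ℚ.≤ 𝔼 μ g
  𝔼-mono = expect-mono nonNeg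

  -- Averaging carries a guarantee against all pure strategies over to mixed ones; what remains is
  -- to count wins against a pure opponent.
  𝔼-≥ : ∀ {v f} → (∀ a → v ℚ.≤ f a) → v ℚ.≤ 𝔼 μ f
  𝔼-≥ {v} v≤f = subst (ℚ._≤ _) (𝔼-const v) (𝔼-mono v≤f)

  𝔼-≤ : ∀ {v f} → (∀ a → f a ℚ.≤ v) → 𝔼 μ f ℚ.≤ v
  𝔼-≤ {v} f≤v = subst (_ ℚ.≤_) (𝔼-const v) (𝔼-mono f≤v)

sumℚ-+ : (as : List A) (f g : A → ℚ) → sumℚ (map (λ a → f a ℚ.+ g a) as) ≡ sumℚ (map f as) ℚ.+ sumℚ (map g as)
sumℚ-+ []       f g = refl
sumℚ-+ (a ∷ as) f g = trans (cong (ℚ._+_ (f a ℚ.+ g a)) (sumℚ-+ as f g)) (interchange (f a) (g a) _ _)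
  where
  open import Algebra.Properties.CommutativeSemigroup (CommutativeMonoid.commutativeSemigroup ℚ.+-0-commutativeMonoid) using (interchange)

sumℚ-*ˡ : (w : ℚ) (as : List A) (f : A → ℚ) → sumℚ (map (λ a → w ℚ.* f a) as) ≡ w ℚ.* sumℚ (map f as)
sumℚ-*ˡ w []       f = sym (ℚ.*-zeroʳ w)
sumℚ-*ˡ w (a ∷ as) f = trans (cong (ℚ._+_ (w ℚ.* f a)) (sumℚ-*ˡ w as f)) (sym (ℚ.*-distribˡ-+ w (f a) _))

sumℚ-0 : (as : List A) → sumℚ (map (λ _ → 0ℚ) as) ≡ 0ℚ
sumℚ-0 []       = refl
sumℚ-0 (a ∷ as) = trans (ℚ.+-identityˡ _) (sumℚ-0 as)

sumℚ-swap : (as : List A) (bs : List B) (f : A → B → ℚ) →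
  sumℚ (map (λ a → sumℚ (map (f a) bs)) as) ≡ sumℚ (map (λ b → sumℚ (map (λ a → f a b) as)) bs)
sumℚ-swap []       bs f = sym (sumℚ-0 bs)
sumℚ-swap (a ∷ as) bs f = trans (cong (ℚ._+_ (sumℚ (map (f a) bs))) (sumℚ-swap as bs f)) (sym (sumℚ-+ bs (f a) _))

-- `IsValue` takes the searcher's expectation outermost, but her guarantee counts winning strategies
-- against a fixed hider; the exchange puts the hider outside.
𝔼-swap : (μ : Mixed A) (ν : Mixed B) (f : A → B → ℚ) →
  𝔼 μ (λ a → 𝔼 ν (f a)) ≡ 𝔼 ν (λ b → 𝔼 μ (λ a → f a b))
𝔼-swap μ ν f = begin
  sumℚ (map (λ a → proj₂ a ℚ.* sumℚ (map (λ b → proj₂ b ℚ.* f (proj₁ a) (proj₁ b)) bs)) as)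
    ≡⟨ cong sumℚ (map-cong (λ a → sumℚ-*ˡ (proj₂ a) bs _) as) ⟨
  sumℚ (map (λ a → sumℚ (map (λ b → proj₂ a ℚ.* (proj₂ b ℚ.* f (proj₁ a) (proj₁ b))) bs)) as)
    ≡⟨ sumℚ-swap as bs _ ⟩
  sumℚ (map (λ b → sumℚ (map (λ a → proj₂ a ℚ.* (proj₂ b ℚ.* f (proj₁ a) (proj₁ b))) as)) bs)
    ≡⟨ cong sumℚ (map-cong (λ b → cong sumℚ (map-cong (λ a → x∙yz≈y∙xz (proj₂ a) (proj₂ b) _) as)) bs) ⟩
  sumℚ (map (λ b → sumℚ (map (λ a → proj₂ b ℚ.* (proj₂ a ℚ.* f (proj₁ a) (proj₁ b))) as)) bs)
    ≡⟨ cong sumℚ (map-cong (λ b → sumℚ-*ˡ (proj₂ b) as _) bs) ⟩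
  sumℚ (map (λ b → proj₂ b ℚ.* sumℚ (map (λ a → proj₂ a ℚ.* f (proj₁ a) (proj₁ b)) as)) bs) ∎
  where
  open ≡-Reasoning
  open import Algebra.Properties.CommutativeSemigroup (CommutativeMonoid.commutativeSemigroup ℚ.*-1-commutativeMonoid) using (x∙yz≈y∙xz)
  as = Mixed.atoms μ
  bs = Mixed.atoms ν

-- The value of the game

[m+d]Cd*d!*m!≡[m+d]! : ∀ m d → ((m + d) C d) * (d ! * m !) ≡ (m + d) !
[m+d]Cd*d!*m!≡[m+d]! m d = begin
  ((m + d) C d) * (d ! * m !)                ≡⟨ cong (λ j → ((m + d) C d) * (d ! * j !)) (sym (m+n∸n≡m m d)) ⟩
  ((m + d) C d) * (d ! * (m + d ∸ d) !)      ≡⟨ cong (_* (d ! * (m + d ∸ d) !)) (nCk≡n!/k![n-k]! (m≤n+m d m)) ⟩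
  _                                          ≡⟨ m/n*n≡m (k![n∸k]!∣n! (m≤n+m d m)) ⟩
  (m + d) !                                  ∎
  where
  open ≡-Reasoning
  instance _ = d !* (m + d ∸ d) !≢0

∑-allFin-lookup : ∀ {n} (v : Vec ℕ n) → ∑ (allFin n) (lookup v) ≡ Vec.sum v
∑-allFin-lookup v = go v id (lookup v) (λ _ → refl)
  where
  go : ∀ {n} {A : Set} (v : Vec ℕ n) (f : Fin n → A) (g : A → ℕ) → (∀ i → g (f i) ≡ lookup v i) →
    ∑ (tabulate f) g ≡ Vec.sum v
  go []      f g eq = refl
  go (x ∷ v) f g eq = cong₂ _+_ (eq zero) (go v (f ∘ Fin.suc) g (eq ∘ Fin.suc))

module _ (n-1 d-1 k-1 : ℕ) where
  private
    n = suc n-1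
    d = suc d-1
    k = suc k-1

  strategies : List (Searcher n k)
  strategies = concatMap (λ xs → map (searcher ∘ seedPlan k-1 d-1 xs) (thresholds n d-1)) (perms (allFin n))

  ∑-strategies : ∀ f → ∑ strategies f ≡
    ∑ (perms (allFin n)) (λ xs → ∑ (thresholds n d-1) (f ∘ searcher ∘ seedPlan k-1 d-1 xs))
  ∑-strategies f = trans
    (∑-concatMap (λ xs → map (searcher ∘ seedPlan k-1 d-1 xs) (thresholds n d-1)) (perms (allFin n)) f)
    (∑-cong (perms (allFin n)) (λ {xs} _ → ∑-map (searcher ∘ seedPlan k-1 d-1 xs) (thresholds n d-1) f))

  length-strategies : length strategies ≡ (n-1 + d) !
  length-strategies = begin
    length strategies                                                       ≡⟨ ∑-one strategies ⟨
    ∑ strategies (λ _ → 1)                                                  ≡⟨ ∑-strategies _ ⟩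
    ∑ (perms (allFin n)) (λ _ → ∑ (thresholds n d-1) (λ _ → 1))             ≡⟨ ∑-const (perms (allFin n)) _ ⟩
    length (perms (allFin n)) * ∑ (thresholds n d-1) (λ _ → 1)
      ≡⟨ cong₂ _*_ (trans (length-perms (allFin n)) (cong _! (length-tabulate {n = n} id))) (∑-one (thresholds n d-1)) ⟩
    n ! * length (thresholds n d-1)                                         ≡⟨ length-thresholds n d-1 ⟩
    (n + d-1) !                                                             ≡⟨ cong _! (+-suc n-1 d-1) ⟨
    (n-1 + d) !                                                             ∎
    where open ≡-Reasoning

  -- Out of `(n-1 + d) !` strategies, this many wins is exactly the fraction
  -- `k ^ d / ((n-1 + d) C d)`. For a seed, `xs` is a permutation of all doors, which supplies the
  -- uniqueness and completeness that the forced runs require.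
  wins-≥ : d + k * d ≤ n → (τ : Hider n d k) →
    k ^ d * (d ! * n-1 !) ≤ ∑ strategies (λ σ → indicator (searcherWins σ τ))
  wins-≥ N≤n τ = begin
    k ^ d * (d ! * n-1 !)
      ≡⟨ Count.goodSeed-count p n-1 d-1 k-1 (allFin n) (length-tabulate {n = n} id)
           (trans (∑-allFin-lookup (proj₁ placement)) (proj₂ placement)) N≤n ⟨
    ∑ (perms (allFin n)) (λ xs → ∑ (thresholds n d-1) (Count.goodSeed p n k-1 d-1 xs))
      ≤⟨ ∑-mono (perms (allFin n)) (λ {xs} xs∈ → ∑-mono (thresholds n d-1) (λ {ts} _ →
           let π = orders-↭ (length (allFin n)) (allFin n) refl xs∈ in
           Winning.goodSeed≤wins τ d-1 xs ts
             (Unique-resp-↭ (setoid (Fin n)) (↭⇒↭ₛ (↭-sym π)) (allFin⁺ n))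
             (λ x → ∈-resp-↭ (↭-sym π) (∈-allFin x)))) ⟩
    ∑ (perms (allFin n)) (λ xs → ∑ (thresholds n d-1) (λ ts →
        indicator (searcherWins (searcher (seedPlan k-1 d-1 xs ts)) τ)))
      ≡⟨ ∑-strategies _ ⟨
    ∑ strategies (λ σ → indicator (searcherWins σ τ)) ∎
    where
    open ≤-Reasoning
    open Hider τ
    p = lookup (proj₁ placement)

  value : d + k * d ≤ n → (nz : NonZero ((n-1 + d) C d)) →
    IsSearchGameValue n d k (_/_ (+ (k ^ d)) ((n-1 + d) C d) {{nz}})
  value N≤n nz = record
    { maximiser = uniform strategies , λ ν → subst (v ℚ.≤_) (sym (𝔼-swap (uniform strategies) ν (winPayoff n d k)))
        (𝔼-≥ ν (λ τ → 𝔼-uniform-≥ strategies (λ σ → searcherWins σ τ) (k ^ d) c (lower τ)))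
    ; minimiser = uniform hiders , λ μ → 𝔼-≤ μ (λ σ →
        𝔼-uniform-≤ hiders (searcherWins σ) (k ^ d) c (*-mono-≤ (upper σ) (≤-reflexive (sym length-hiders))))
    }
    where
    c = (n-1 + d) C d
    T = length strategies
    hiders : List (Hider n d k)
    hiders = map (obliging zero) (placements n d)
    length-hiders : length hiders ≡ c
    length-hiders = trans (length-map (obliging zero) (placements n d)) (length-placements n-1 d)
    instance
      _ = nz
      T≢0 : NonZero T
      T≢0 = subst NonZero (sym length-strategies) ((n-1 + d) !≢0)
      hiders≢0 : NonZero (length hiders)
      hiders≢0 = subst NonZero (sym length-hiders) nz
    v = + (k ^ d) / c
    lower : ∀ τ → k ^ d * T ≤ ∑ strategies (λ σ → indicator (searcherWins σ τ)) * c
    lower τ = begin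
      k ^ d * T                         ≡⟨ cong (k ^ d *_) (trans length-strategies (sym ([m+d]Cd*d!*m!≡[m+d]! n-1 d))) ⟩
      k ^ d * (c * (d ! * n-1 !))       ≡⟨ cong (k ^ d *_) (*-comm c _) ⟩
      k ^ d * (d ! * n-1 ! * c)         ≡⟨ *-assoc (k ^ d) _ c ⟨
      k ^ d * (d ! * n-1 !) * c         ≤⟨ *-monoˡ-≤ c (wins-≥ N≤n τ) ⟩
      ∑ strategies (λ σ → indicator (searcherWins σ τ)) * c ∎
      where open ≤-Reasoning
    upper : ∀ σ → ∑ hiders (λ τ → indicator (searcherWins σ τ)) ≤ k ^ d
    upper σ = ≤-trans (≤-reflexive (∑-map (obliging zero) (placements n d) _))
      (wins≤k^r zero σ (placements n d) (placements-distinct n d) d [])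

theorem2 : (d k : ℕ) → .{{_ : NonZero d}} → .{{_ : NonZero k}} →
    ∃[ N ] ((n : ℕ) → N ≤ n →
    Σ[ nz ∈ NonZero ((n + d ∸ 1) C d) ]
    IsSearchGameValue n d k (_/_ (+ (k ^ d)) ((n + d ∸ 1) C d) {{nz}}))
-- The `d` doors allow for the occupied ones and the `k * d` for empty doors to fill the guesses;
-- `k * d ≤ n` also keeps each `k * (l + r)` within the range of its threshold.
theorem2 d@(suc d-1) k@(suc k-1) = d + k * d , λ where
  -- `N` is positive, so `n` is a successor and `n + d ∸ 1` computes to `n-1 + d`. The binomial
  -- coefficient is nonzero as a factor of `(n-1 + d) !`.
  (suc n-1) N≤n → let nz = m*n≢0⇒m≢0 _ {{subst NonZero (sym ([m+d]Cd*d!*m!≡[m+d]! n-1 d)) ((n-1 + d) !≢0)}} in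
    nz , value n-1 d-1 k-1 N≤n nz
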